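{- Let $G=(V,E)$ be a distance-regular graph of diameter $d=\mathrm{d}(G)\ge1$ with distinct eigenvalues $k=\theta_0>\theta_1>\cdots>\theta_{d}$, let $t$ be an integer with $0\le t\le d-1$, let $$P(x)=\alpha_1K^{(1)}(x)+\cdots+\alpha_{d}K^{(d)}(x)$$ where $\alpha_i\ge0$ are real numbers, $i=1,\ldots,d$, and $K^{(i)}$ is the degree-$i$ polynomial such that the adjacency matrix of the distance-$i$ graph of $G$ equals $K^{(i)}(A)$, $A$ being the adjacency matrix of $G$. Let $$\mu=\max\{P(\theta_{t+1}),\ldots,P(\theta_{d})\}.$$ If $\mu<0$, then the cardinality of any nonempty algebraic $t$-design $C$ in $G$ satisfies $$\frac{|C|}{|V|}\ \ge\ \frac{ -\mu}{P(k)-\mu}.$$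
   Context: For a connected graph $G$, $\mathrm{d}(G)$ is its diameter and $G^{(j)}$ is the simple graph on the same vertices in which two vertices are adjacent iff their distance in $G$ is $j$; $A^{(j)}$ is the adjacency matrix of $G^{(j)}$ (and $A=A^{(1)}$, with $A^{(0)}$ the identity matrix). A simple connected graph $G$ is distance-regular if for each $i=1,\ldots,\mathrm{d}(G)$ the product $A^{(1)}A^{(i)}$ is a linear combination of $A^{(i-1)},A^{(i)},A^{(i+1)}$ (where $A^{(\mathrm{d}(G)+1)}=0$). For such $G$ there are polynomials $K^{(i)}$ of degree $i$, $i=0,\ldots,\mathrm{d}(G)$, with $A^{(i)}=K^{(i)}(A)$. $k$ denotes the degree of $G$, and $G$ has exactly $\mathrm{d}(G)+1$ distinct eigenvalues. Algebraic $t$-design: for a regular graph with distinct eigenvalues $\theta_0>\theta_1>\cdots>\theta_d$ and corresponding eigenspaces $S_0,\ldots,S_d\subseteq\mathbb{C}^V$, a multiset $C$ of vertices is an algebraic $t$-design if in the decomposition $f_C=\varphi_0+\cdots+\varphi_d$, $\varphi_i\in S_i$, of its multiplicity function $f_C$ one has $\varphi_1=\cdots=\varphi_t\equiv0$. The cardinality $|C|$ counts multiplicities. -}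

module Defs where

open import Algebra.Bundles.Raw using (RawMonoid)
import Algebra.Definitions.RawMonoid as RawSum
open import Data.Bool.Base using (if_then_else_)
open import Data.Fin.Base as Fin using (Fin; zero; suc; toℕ)
import Data.Fin.Properties as Fin
open import Data.Integer.Base as ℤ using ()
open import Data.List.Base using (foldr; map; filter; length; allFin)
open import Data.Nat.Base as ℕ using (ℕ; zero; suc)
import Data.Nat.Properties as ℕ
open import Data.Product.Base using (Σ; ∃; ∃₂; _×_; _,_)
open import Data.Rational.Base as ℚ using (ℚ; 0ℚ; 1ℚ; ½; ∣_∣)
import Data.Rational.Properties as ℚ
open import Data.Rational.Solver using (module +-*-Solver)
open import Data.Sum.Base using (_⊎_; inj₁; inj₂)
open import Relation.Binary.PropositionalEquality using (_≡_; _≢_; refl; sym; trans; cong; cong₂; subst; subst₂)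
open import Relation.Nullary.Decidable using (Dec; yes; no; does; _×-dec_; ¬?)
open import Relation.Nullary.Negation using (¬_; contradiction)

-- The real numbers, as the setoid of rational Cauchy sequences.

Cauchy : (ℕ → ℚ) → Set
Cauchy x = ∀ ε → 0ℚ ℚ.< ε → ∃ λ N → ∀ m n → N ℕ.≤ m → N ℕ.≤ n → ∣ x m ℚ.- x n ∣ ℚ.< ε

record ℝ : Set where
  constructor mkℝ
  field
    seq    : ℕ → ℚ
    cauchy : Cauchy seq

open ℝ public

infix 4 _≈_ _≤_ _<_ _#_

record _≈_ (x y : ℝ) : Set where
  constructor mk≈
  field
    close : ∀ ε → 0ℚ ℚ.< ε → ∃ λ N → ∀ n → N ℕ.≤ n → ∣ seq x n ℚ.- seq y n ∣ ℚ.< ε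

record _≤_ (x y : ℝ) : Set where
  constructor mk≤
  field
    below : ∀ ε → 0ℚ ℚ.< ε → ∃ λ N → ∀ n → N ℕ.≤ n → seq x n ℚ.< seq y n ℚ.+ ε

record _<_ (x y : ℝ) : Set where
  constructor mk<
  field
    gap       : ℚ
    gap-pos   : 0ℚ ℚ.< gap
    index     : ℕ
    separated : ∀ n → index ℕ.≤ n → seq x n ℚ.+ gap ℚ.< seq y n

_#_ : ℝ → ℝ → Set
x # y = x < y ⊎ y < x

-- The arithmetic operations and the binary maximum act termwise on Cauchy sequences.

module Estimates where
  open +-*-Solver using (solve; _:+_; _:*_; :-_; _:=_) renaming (_:-_ to _:−_)

  swap : ∀ p q → p ℚ.- q ≡ ℚ.- (q ℚ.- p)
  swap = solve 2 (λ p q → p :− q := :- (q :− p)) refl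

  +-cancel : ∀ p q → q ℚ.+ (p ℚ.- q) ≡ p
  +-cancel = solve 2 (λ p q → q :+ (p :− q) := p) refl

  cancel-+ : ∀ p q → (p ℚ.+ q) ℚ.- p ≡ q
  cancel-+ = solve 2 (λ p q → (p :+ q) :− p := q) refl

  neg-difference : ∀ p q → q ℚ.- p ≡ (ℚ.- p) ℚ.- (ℚ.- q)
  neg-difference = solve 2 (λ p q → q :− p := (:- p) :− (:- q)) refl

  sum-difference : ∀ p q r s → (p ℚ.- q) ℚ.+ (r ℚ.- s) ≡ (p ℚ.+ r) ℚ.- (q ℚ.+ s)
  sum-difference = solve 4 (λ p q r s → (p :− q) :+ (r :− s) := (p :+ r) :− (q :+ s)) refl

  product-difference : ∀ p q r s → p ℚ.* (r ℚ.- s) ℚ.+ s ℚ.* (p ℚ.- q) ≡ p ℚ.* r ℚ.- q ℚ.* s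
  product-difference = solve 4 (λ p q r s → p :* (r :− s) :+ s :* (p :− q) := p :* r :− q :* s) refl

  inv-product : ∀ a b p q → (a ℚ.- b) ℚ.* (p ℚ.* q) ≡ (a ℚ.* p) ℚ.* q ℚ.- (b ℚ.* q) ℚ.* p
  inv-product = solve 4 (λ a b p q → (a :− b) :* (p :* q) := (a :* p) :* q :− (b :* q) :* p) refl

  half-pos : ∀ {ε} → 0ℚ ℚ.< ε → 0ℚ ℚ.< ½ ℚ.* ε
  half-pos {ε} 0<ε = subst (ℚ._< ½ ℚ.* ε) (ℚ.*-zeroʳ ½) (ℚ.*-monoʳ-<-pos ½ 0<ε)

  half+half : ∀ ε → ½ ℚ.* ε ℚ.+ ½ ℚ.* ε ≡ ε
  half+half ε = trans (sym (ℚ.*-distribʳ-+ ε ½ ½)) (ℚ.*-identityˡ ε)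

  *-pos : ∀ {p q} → 0ℚ ℚ.< p → 0ℚ ℚ.< q → 0ℚ ℚ.< p ℚ.* q
  *-pos {p} {q} 0<p 0<q =
    subst (ℚ._< p ℚ.* q) (ℚ.*-zeroʳ p) (ℚ.*-monoʳ-<-pos p {{ℚ.positive 0<p}} 0<q)

  ∣-∣-swap : ∀ p q → ∣ p ℚ.- q ∣ ≡ ∣ q ℚ.- p ∣
  ∣-∣-swap p q = trans (cong ∣_∣ (swap p q)) (ℚ.∣-p∣≡∣p∣ (q ℚ.- p))

  p≤∣p∣ : ∀ p → p ℚ.≤ ∣ p ∣
  p≤∣p∣ p with ℚ.≤-total 0ℚ p
  ... | inj₁ 0≤p = ℚ.≤-reflexive (sym (ℚ.0≤p⇒∣p∣≡p 0≤p))
  ... | inj₂ p≤0 = ℚ.≤-trans p≤0 (ℚ.0≤∣p∣ p)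

  ∣∣<⇒< : ∀ p q {ε} → ∣ p ℚ.- q ∣ ℚ.< ε → p ℚ.< q ℚ.+ ε
  ∣∣<⇒< p q {ε} h =
    subst (ℚ._< q ℚ.+ ε) (+-cancel p q)
      (ℚ.+-monoʳ-< q (ℚ.≤-<-trans (p≤∣p∣ (p ℚ.- q)) h))

  <⇒∣∣< : ∀ p q {ε} → p ℚ.< q ℚ.+ ε → q ℚ.< p ℚ.+ ε → ∣ p ℚ.- q ∣ ℚ.< ε
  <⇒∣∣< p q {ε} p< q< with ℚ.∣p∣≡p∨∣p∣≡-p (p ℚ.- q)
  ... | inj₁ eq = subst (ℚ._< ε) (sym eq)
    (subst₂ ℚ._<_ refl (cancel-+ q ε) (ℚ.+-monoˡ-< (ℚ.- q) p<))
  ... | inj₂ eq = subst (ℚ._< ε) (sym eq)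
    (subst₂ ℚ._<_ (swap q p)
      (cancel-+ p ε) (ℚ.+-monoˡ-< (ℚ.- p) q<))

  ⊔-<-lub : ∀ p q {r} → p ℚ.< r → q ℚ.< r → p ℚ.⊔ q ℚ.< r
  ⊔-<-lub p q {r} p<r q<r with ℚ.⊔-sel p q
  ... | inj₁ eq = subst (ℚ._< r) (sym eq) p<r
  ... | inj₂ eq = subst (ℚ._< r) (sym eq) q<r

  ⊔-close : ∀ p q r s {ε} → ∣ p ℚ.- r ∣ ℚ.< ε → ∣ q ℚ.- s ∣ ℚ.< ε → p ℚ.⊔ q ℚ.< (r ℚ.⊔ s) ℚ.+ ε
  ⊔-close p q r s {ε} h k = ⊔-<-lub p q
    (ℚ.<-≤-trans (∣∣<⇒< p r h) (ℚ.+-monoˡ-≤ ε (ℚ.p≤p⊔q r s)))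
    (ℚ.<-≤-trans (∣∣<⇒< q s k) (ℚ.+-monoˡ-≤ ε (ℚ.p≤q⊔p r s)))

  bounded : ∀ x → Cauchy x → ∃ λ B → 0ℚ ℚ.< B × ∃ λ N → ∀ n → N ℕ.≤ n → ∣ x n ∣ ℚ.< B
  bounded x cx with cx 1ℚ (ℚ.positive⁻¹ 1ℚ)
  ... | N , h = 1ℚ ℚ.+ ∣ x N ∣ , ℚ.+-mono-<-≤ (ℚ.positive⁻¹ 1ℚ) (ℚ.0≤∣p∣ (x N)) , N , λ n N≤n →
    ℚ.≤-<-trans
      (subst (λ p → ∣ p ∣ ℚ.≤ ∣ x n ℚ.- x N ∣ ℚ.+ ∣ x N ∣)
        (trans (ℚ.+-comm (x n ℚ.- x N) (x N)) (+-cancel (x n) (x N)))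
        (ℚ.∣p+q∣≤∣p∣+∣q∣ (x n ℚ.- x N) (x N)))
      (ℚ.+-monoˡ-< ∣ x N ∣ (h n N N≤n ℕ.≤-refl))

  -- For 0 < B, an amount δ with B * δ = ε / 2.
  share : ∀ B ε → 0ℚ ℚ.< B → 0ℚ ℚ.< ε → ∃ λ δ → 0ℚ ℚ.< δ × B ℚ.* δ ≡ ½ ℚ.* ε
  share B ε 0<B 0<ε = 1/B ℚ.* (½ ℚ.* ε) , *-pos 0<1/B (half-pos 0<ε) ,
    trans (sym (ℚ.*-assoc B 1/B (½ ℚ.* ε)))
      (trans (cong (ℚ._* (½ ℚ.* ε)) (ℚ.*-inverseʳ B)) (ℚ.*-identityˡ (½ ℚ.* ε)))
    where
    instance
      B-pos     = ℚ.positive 0<B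
      B-nonZero = ℚ.pos⇒nonZero B
    1/B = ℚ.1/ B
    0<1/B : 0ℚ ℚ.< 1/B
    0<1/B = ℚ.positive⁻¹ 1/B {{ℚ.1/pos⇒pos B}}

  *-mono-∣∣ : ∀ p q {B δ} → 0ℚ ℚ.< B → ∣ p ∣ ℚ.< B → ∣ q ∣ ℚ.< δ → ∣ p ℚ.* q ∣ ℚ.< B ℚ.* δ
  *-mono-∣∣ p q {B} {δ} 0<B p<B q<δ = subst (ℚ._< B ℚ.* δ) (sym (ℚ.∣p*q∣≡∣p∣*∣q∣ p q)) (ℚ.≤-<-trans
    (ℚ.*-monoʳ-≤-nonNeg ∣ q ∣ {{ℚ.nonNegative (ℚ.0≤∣p∣ q)}} (ℚ.<⇒≤ p<B))
    (ℚ.*-monoʳ-<-pos B {{ℚ.positive 0<B}} q<δ))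

  *-close : ∀ p q r s {A B δ η ε} → 0ℚ ℚ.< A → 0ℚ ℚ.< B → A ℚ.* δ ≡ ½ ℚ.* ε → B ℚ.* η ≡ ½ ℚ.* ε →
            ∣ p ∣ ℚ.< A → ∣ s ∣ ℚ.< B → ∣ r ℚ.- s ∣ ℚ.< δ → ∣ p ℚ.- q ∣ ℚ.< η →
            ∣ p ℚ.* r ℚ.- q ℚ.* s ∣ ℚ.< ε
  *-close p q r s {ε = ε} 0<A 0<B Aδ Bη p<A s<B Δr Δp =
    subst₂ ℚ._<_ (cong ∣_∣ (product-difference p q r s)) (trans (cong₂ ℚ._+_ Aδ Bη) (half+half ε))
      (ℚ.≤-<-trans (ℚ.∣p+q∣≤∣p∣+∣q∣ (p ℚ.* (r ℚ.- s)) (s ℚ.* (p ℚ.- q)))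
        (ℚ.+-mono-< (*-mono-∣∣ p (r ℚ.- s) 0<A p<A Δr) (*-mono-∣∣ s (p ℚ.- q) 0<B s<B Δp)))

open Estimates

-- Agrees with 1/_ away from zero; termwise inversion needs a total function because
-- finitely many terms of a nonzero real may vanish.
invℚ : ℚ → ℚ
invℚ q with q ℚ.≟ 0ℚ
... | yes _   = 0ℚ
... | no  q≢0 = (ℚ.1/ q) {{ℚ.≢-nonZero q≢0}}

module InverseEstimates where
  invℚ-inverse : ∀ q → q ≢ 0ℚ → invℚ q ℚ.* q ≡ 1ℚ
  invℚ-inverse q q≢0 with q ℚ.≟ 0ℚ
  ... | yes q≡0 = contradiction q≡0 q≢0
  ... | no  q≢0 = ℚ.*-inverseˡ q {{ℚ.≢-nonZero q≢0}}

  invℚ-close : ∀ p q {δ ε} → 0ℚ ℚ.< δ → 0ℚ ℚ.< ε → δ ℚ.< ∣ p ∣ → δ ℚ.< ∣ q ∣ →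
               ∣ p ℚ.- q ∣ ℚ.< ε ℚ.* (δ ℚ.* δ) → ∣ invℚ p ℚ.- invℚ q ∣ ℚ.< ε
  invℚ-close p q {δ} {ε} 0<δ 0<ε δ<p δ<q h =
    ℚ.*-cancelʳ-<-nonNeg (∣ p ∣ ℚ.* ∣ q ∣) {{ℚ.nonNegative 0≤pq}} (ℚ.<-≤-trans
      (subst (ℚ._< ε ℚ.* (δ ℚ.* δ)) (sym lhs) h)
      (ℚ.*-monoˡ-≤-nonNeg ε {{ℚ.nonNegative (ℚ.<⇒≤ 0<ε)}} (ℚ.≤-trans
        (ℚ.*-monoˡ-≤-nonNeg δ {{ℚ.nonNegative (ℚ.<⇒≤ 0<δ)}} (ℚ.<⇒≤ δ<q))
        (ℚ.*-monoʳ-≤-nonNeg ∣ q ∣ {{ℚ.nonNegative (ℚ.0≤∣p∣ q)}} (ℚ.<⇒≤ δ<p)))))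
    where
    0≤pq : 0ℚ ℚ.≤ ∣ p ∣ ℚ.* ∣ q ∣
    0≤pq = ℚ.<⇒≤ (*-pos (ℚ.<-trans 0<δ δ<p) (ℚ.<-trans 0<δ δ<q))

    nonzero : ∀ r → δ ℚ.< ∣ r ∣ → r ≢ 0ℚ
    nonzero r δ<r refl = ℚ.<-asym 0<δ δ<r

    product : (invℚ p ℚ.- invℚ q) ℚ.* (p ℚ.* q) ≡ q ℚ.- p
    product =
      trans (inv-product (invℚ p) (invℚ q) p q)
      (trans (cong₂ (λ u v → u ℚ.* q ℚ.- v ℚ.* p)
                    (invℚ-inverse p (nonzero p δ<p)) (invℚ-inverse q (nonzero q δ<q)))
             (cong₂ (λ u v → u ℚ.- v) (ℚ.*-identityˡ q) (ℚ.*-identityˡ p)))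

    lhs : ∣ invℚ p ℚ.- invℚ q ∣ ℚ.* (∣ p ∣ ℚ.* ∣ q ∣) ≡ ∣ p ℚ.- q ∣
    lhs = trans (cong (∣ invℚ p ℚ.- invℚ q ∣ ℚ.*_) (sym (ℚ.∣p*q∣≡∣p∣*∣q∣ p q)))
      (trans (sym (ℚ.∣p*q∣≡∣p∣*∣q∣ (invℚ p ℚ.- invℚ q) (p ℚ.* q)))
        (trans (cong ∣_∣ product) (∣-∣-swap q p)))

open InverseEstimates

abstract
  const-cauchy : ∀ q → Cauchy (λ _ → q)
  const-cauchy q ε 0<ε = 0 , λ _ _ _ _ → subst (λ p → ∣ p ∣ ℚ.< ε) (sym (ℚ.+-inverseʳ q)) 0<ε

  +-cauchy : ∀ x y → Cauchy x → Cauchy y → Cauchy (λ n → x n ℚ.+ y n)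
  +-cauchy x y cx cy ε 0<ε
    with cx (½ ℚ.* ε) (half-pos 0<ε) | cy (½ ℚ.* ε) (half-pos 0<ε)
  ... | N , h | M , k = N ℕ.⊔ M , λ m n ≤m ≤n →
    subst₂ ℚ._<_
      (cong ∣_∣ (sum-difference (x m) (x n) (y m) (y n)))
      (half+half ε)
      (ℚ.≤-<-trans (ℚ.∣p+q∣≤∣p∣+∣q∣ (x m ℚ.- x n) (y m ℚ.- y n))
        (ℚ.+-mono-< (h m n (ℕ.m⊔n≤o⇒m≤o N M ≤m) (ℕ.m⊔n≤o⇒m≤o N M ≤n))
                    (k m n (ℕ.m⊔n≤o⇒n≤o N M ≤m) (ℕ.m⊔n≤o⇒n≤o N M ≤n))))

  neg-cauchy : ∀ x → Cauchy x → Cauchy (λ n → ℚ.- x n)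
  neg-cauchy x cx ε 0<ε with cx ε 0<ε
  ... | N , h = N , λ m n ≤m ≤n →
    subst (ℚ._< ε)
      (trans (∣-∣-swap (x m) (x n))
             (cong ∣_∣ (neg-difference (x m) (x n))))
      (h m n ≤m ≤n)

  *-cauchy : ∀ x y → Cauchy x → Cauchy y → Cauchy (λ n → x n ℚ.* y n)
  *-cauchy x y cx cy ε 0<ε =
    let A , 0<A , Nx , bx = bounded x cx
        B , 0<B , Ny , by = bounded y cy
        δ , 0<δ , Aδ      = share A ε 0<A 0<ε
        η , 0<η , Bη      = share B ε 0<B 0<ε
        N , h             = cy δ 0<δ
        M , k             = cx η 0<η
    in (Nx ℕ.⊔ Ny) ℕ.⊔ (N ℕ.⊔ M) , λ m n ≤m ≤n →
    let ≤m₁ = ℕ.m⊔n≤o⇒m≤o (Nx ℕ.⊔ Ny) (N ℕ.⊔ M) ≤m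
        ≤m₂ = ℕ.m⊔n≤o⇒n≤o (Nx ℕ.⊔ Ny) (N ℕ.⊔ M) ≤m
        ≤n₁ = ℕ.m⊔n≤o⇒m≤o (Nx ℕ.⊔ Ny) (N ℕ.⊔ M) ≤n
        ≤n₂ = ℕ.m⊔n≤o⇒n≤o (Nx ℕ.⊔ Ny) (N ℕ.⊔ M) ≤n
    in *-close (x m) (x n) (y m) (y n) 0<A 0<B Aδ Bη
         (bx m (ℕ.m⊔n≤o⇒m≤o Nx Ny ≤m₁)) (by n (ℕ.m⊔n≤o⇒n≤o Nx Ny ≤n₁))
         (h m n (ℕ.m⊔n≤o⇒m≤o N M ≤m₂) (ℕ.m⊔n≤o⇒m≤o N M ≤n₂))
         (k m n (ℕ.m⊔n≤o⇒n≤o N M ≤m₂) (ℕ.m⊔n≤o⇒n≤o N M ≤n₂))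

  ⊔-cauchy : ∀ x y → Cauchy x → Cauchy y → Cauchy (λ n → x n ℚ.⊔ y n)
  ⊔-cauchy x y cx cy ε 0<ε with cx ε 0<ε | cy ε 0<ε
  ... | N , h | M , k = N ℕ.⊔ M , λ m n ≤m ≤n →
    let N≤m = ℕ.m⊔n≤o⇒m≤o N M ≤m
        N≤n = ℕ.m⊔n≤o⇒m≤o N M ≤n
        M≤m = ℕ.m⊔n≤o⇒n≤o N M ≤m
        M≤n = ℕ.m⊔n≤o⇒n≤o N M ≤n
    in <⇒∣∣< (x m ℚ.⊔ y m) (x n ℚ.⊔ y n)
         (⊔-close (x m) (y m) (x n) (y n) (h m n N≤m N≤n) (k m n M≤m M≤n))
         (⊔-close (x n) (y n) (x m) (y m) (h n m N≤n N≤m) (k n m M≤n M≤m))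

infixl 6 _+_ _-_ _⊔_
infixl 7 _*_ _÷_
infix  8 -_

fromℚ : ℚ → ℝ
fromℚ q = mkℝ (λ _ → q) (const-cauchy q)

fromℕ : ℕ → ℝ
fromℕ n = fromℚ (ℤ.+ n ℚ./ 1)

0ℝ 1ℝ : ℝ
0ℝ = fromℚ 0ℚ
1ℝ = fromℚ 1ℚ

-_ : ℝ → ℝ
- x = mkℝ (λ n → ℚ.- seq x n) (neg-cauchy (seq x) (cauchy x))

_+_ : ℝ → ℝ → ℝ
x + y = mkℝ (λ n → seq x n ℚ.+ seq y n) (+-cauchy (seq x) (seq y) (cauchy x) (cauchy y))

_*_ : ℝ → ℝ → ℝ
x * y = mkℝ (λ n → seq x n ℚ.* seq y n) (*-cauchy (seq x) (seq y) (cauchy x) (cauchy y))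

_-_ : ℝ → ℝ → ℝ
x - y = x + (- y)

_⊔_ : ℝ → ℝ → ℝ
x ⊔ y = mkℝ (λ n → seq x n ℚ.⊔ seq y n) (⊔-cauchy (seq x) (seq y) (cauchy x) (cauchy y))

away : ∀ {x} → x # 0ℝ → ∃ λ δ → 0ℚ ℚ.< δ × ∃ λ N → ∀ n → N ℕ.≤ n → δ ℚ.< ∣ seq x n ∣
away {x} (inj₂ (mk< δ 0<δ N h)) = δ , 0<δ , N , λ n N≤n →
  ℚ.<-≤-trans (subst (ℚ._< seq x n) (ℚ.+-identityˡ δ) (h n N≤n)) (p≤∣p∣ (seq x n))
away {x} (inj₁ (mk< δ 0<δ N h)) = δ , 0<δ , N , λ n N≤n →
  subst (δ ℚ.<_) (ℚ.∣-p∣≡∣p∣ (seq x n)) (ℚ.<-≤-trans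
    (subst₂ ℚ._<_ (cancel-+ (seq x n) δ) (ℚ.+-identityˡ (ℚ.- seq x n))
      (ℚ.+-monoˡ-< (ℚ.- seq x n) (h n N≤n)))
    (p≤∣p∣ (ℚ.- seq x n)))

abstract
  inv-cauchy : ∀ {x} → x # 0ℝ → Cauchy (λ n → invℚ (seq x n))
  inv-cauchy {x} x#0 ε 0<ε with away x#0
  ... | δ , 0<δ , N , h with cauchy x (ε ℚ.* (δ ℚ.* δ)) (*-pos 0<ε (*-pos 0<δ 0<δ))
  ... | M , k = N ℕ.⊔ M , λ m n ≤m ≤n →
    invℚ-close (seq x m) (seq x n) 0<δ 0<ε
      (h m (ℕ.m⊔n≤o⇒m≤o N M ≤m)) (h n (ℕ.m⊔n≤o⇒m≤o N M ≤n))
      (k m n (ℕ.m⊔n≤o⇒n≤o N M ≤m) (ℕ.m⊔n≤o⇒n≤o N M ≤n))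

inv : (x : ℝ) → x # 0ℝ → ℝ
inv x x#0 = mkℝ (λ n → invℚ (seq x n)) (inv-cauchy x#0)

_÷_ : ℝ → Σ ℝ (_# 0ℝ) → ℝ
x ÷ (y , y#0) = x * inv y y#0

+-rawMonoid : RawMonoid _ _
+-rawMonoid = record { Carrier = ℝ ; _≈_ = _≈_ ; _∙_ = _+_ ; ε = 0ℝ }

sum : ∀ {n} → (Fin n → ℝ) → ℝ
sum = RawSum.sum +-rawMonoid

infixr 8 _^_

_^_ : ℝ → ℕ → ℝ
x ^ zero  = 1ℝ
x ^ suc n = x * x ^ n

-- Complex numbers, with only the real-linear structure that is needed to speak
-- of the eigenspaces in ℂ^V of a real matrix at real eigenvalues.

infix 4 _≈ᶜ_
infixl 6 _+ᶜ_
infixr 7 _•_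

record ℂ : Set where
  constructor _+i_
  field
    re im : ℝ

open ℂ public

_≈ᶜ_ : ℂ → ℂ → Set
z ≈ᶜ w = re z ≈ re w × im z ≈ im w

ofReal : ℝ → ℂ
ofReal x = x +i 0ℝ

0ᶜ : ℂ
0ᶜ = ofReal 0ℝ

_+ᶜ_ : ℂ → ℂ → ℂ
z +ᶜ w = (re z + re w) +i (im z + im w)

_•_ : ℝ → ℂ → ℂ
r • z = (r * re z) +i (r * im z)

+ᶜ-rawMonoid : RawMonoid _ _
+ᶜ-rawMonoid = record { Carrier = ℂ ; _≈_ = _≈ᶜ_ ; _∙_ = _+ᶜ_ ; ε = 0ᶜ }

sumᶜ : ∀ {n} → (Fin n → ℂ) → ℂ
sumᶜ = RawSum.sum +ᶜ-rawMonoid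

Matrix : ℕ → Set
Matrix n = Fin n → Fin n → ℝ

infix 4 _≈ᴹ_
infixl 7 _*ᴹ_
infixr 8 _^ᴹ_

_≈ᴹ_ : ∀ {n} → Matrix n → Matrix n → Set
M ≈ᴹ N = ∀ u v → M u v ≈ N u v

identity : ∀ {n} → Matrix n
identity u v = if does (u Fin.≟ v) then 1ℝ else 0ℝ

_*ᴹ_ : ∀ {n} → Matrix n → Matrix n → Matrix n
(M *ᴹ N) u v = sum (λ w → M u w * N w v)

_^ᴹ_ : ∀ {n} → Matrix n → ℕ → Matrix n
M ^ᴹ zero  = identity
M ^ᴹ suc j = M *ᴹ (M ^ᴹ j)

InEigenspace : ∀ {n} → Matrix n → ℝ → (Fin n → ℂ) → Set
InEigenspace M λ′ φ = ∀ u → sumᶜ (λ v → M u v • φ v) ≈ᶜ λ′ • φ u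

IsEigenvalue : ∀ {n} → Matrix n → ℝ → Set
IsEigenvalue M λ′ = ∃ λ φ → InEigenspace M λ′ φ × ¬ (∀ v → φ v ≈ᶜ 0ᶜ)

-- Real polynomials of degree exactly m.
record Polynomial (m : ℕ) : Set where
  field
    coeff     : Fin (suc m) → ℝ
    leading≉0 : ¬ (coeff (Fin.fromℕ m) ≈ 0ℝ)

open Polynomial public

eval : ∀ {m} → Polynomial m → ℝ → ℝ
eval p x = sum (λ j → coeff p j * x ^ toℕ j)

evalᴹ : ∀ {m n} → Polynomial m → Matrix n → Matrix n
evalᴹ p M u v = sum (λ j → coeff p j * (M ^ᴹ toℕ j) u v)

-- Finite simple graphs with vertex set Fin n.
record SimpleGraph (n : ℕ) : Set₁ where
  field
    _~_      : Fin n → Fin n → Set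
    ~-sym    : ∀ {u v} → u ~ v → v ~ u
    ~-irrefl : ∀ {v} → ¬ (v ~ v)
    _~?_     : ∀ u v → Dec (u ~ v)

module _ {n : ℕ} (G : SimpleGraph n) where
  open SimpleGraph G

  adjacencyMatrix : Matrix n
  adjacencyMatrix u v = if does (u ~? v) then 1ℝ else 0ℝ

  degree : Fin n → ℕ
  degree v = length (filter (v ~?_) (allFin n))

  IsRegular : ℕ → Set
  IsRegular k = ∀ v → degree v ≡ k

  Walk : ℕ → Fin n → Fin n → Set
  Walk zero    u v = u ≡ v
  Walk (suc ℓ) u v = ∃ λ w → u ~ w × Walk ℓ w v

  walk? : ∀ ℓ u v → Dec (Walk ℓ u v)
  walk? zero    u v = u Fin.≟ v
  walk? (suc ℓ) u v = Fin.any? (λ w → (u ~? w) ×-dec walk? ℓ w v)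

  Connected : Set
  Connected = ∀ u v → ∃ λ ℓ → Walk ℓ u v

  IsDistance : ℕ → Fin n → Fin n → Set
  IsDistance j u v = Walk j u v × (∀ {i} → i ℕ.< j → ¬ Walk i u v)

  isDistance? : ∀ j u v → Dec (IsDistance j u v)
  isDistance? j u v = walk? j u v ×-dec ℕ.allUpTo? (λ i → ¬? (walk? i u v)) j

  IsDiameter : ℕ → Set
  IsDiameter d = (∀ u v → ∃ λ j → j ℕ.≤ d × IsDistance j u v) × (∃₂ λ u v → IsDistance d u v)

  walk-snoc : ∀ ℓ {u v w} → Walk ℓ u v → v ~ w → Walk (suc ℓ) u w
  walk-snoc zero    refl          v~w = _ , v~w , refl
  walk-snoc (suc ℓ) (x , u~x , p) v~w = x , u~x , walk-snoc ℓ p v~w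

  walk-reverse : ∀ ℓ {u v} → Walk ℓ u v → Walk ℓ v u
  walk-reverse zero    refl          = refl
  walk-reverse (suc ℓ) (x , u~x , p) = walk-snoc ℓ (walk-reverse ℓ p) (~-sym u~x)

  distanceGraph : (j : ℕ) .{{_ : ℕ.NonZero j}} → SimpleGraph n
  distanceGraph j@(suc _) = record
    { _~_      = IsDistance j
    ; ~-sym    = λ (p , min) → walk-reverse j p , λ {i} i<j q → min i<j (walk-reverse i q)
    ; ~-irrefl = λ (_ , min) → min ℕ.z<s refl
    ; _~?_     = isDistance? j
    }

distanceMatrix : ∀ {n} → SimpleGraph n → ℕ → Matrix n
distanceMatrix G zero      = identity
distanceMatrix G j@(suc _) = adjacencyMatrix (distanceGraph G j)

-- distanceMatrix G (suc d) is zero when d is the diameter, so the case i = d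
-- of the recurrence needs no separate convention.
record IsDistanceRegular {n} (G : SimpleGraph n) (d : ℕ) : Set where
  field
    connected  : Connected G
    diameter   : IsDiameter G d
    recurrence : ∀ i → 1 ℕ.≤ i → i ℕ.≤ d → ∃ λ a → ∃ λ b → ∃ λ c → ∀ u v →
      (distanceMatrix G 1 *ᴹ distanceMatrix G i) u v
        ≈ a * distanceMatrix G (i ℕ.∸ 1) u v + b * distanceMatrix G i u v + c * distanceMatrix G (suc i) u v

-- θ 0 > θ 1 > ⋯ > θ d are all the distinct eigenvalues of G.
record IsSpectrum {n d} (G : SimpleGraph n) (θ : Fin (suc d) → ℝ) : Set where
  field
    decreasing : ∀ {i j} → i Fin.< j → θ j < θ i
    eigenvalue : ∀ i → IsEigenvalue (adjacencyMatrix G) (θ i)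
    exhaustive : ∀ {λ′} → IsEigenvalue (adjacencyMatrix G) λ′ → ∃ λ i → λ′ ≈ θ i

-- A multiset of vertices is given by its multiplicity function.
Multiset : ℕ → Set
Multiset n = Fin n → ℕ

cardinality : ∀ {n} → Multiset n → ℕ
cardinality = RawSum.sum ℕ.+-0-rawMonoid

Nonempty : ∀ {n} → Multiset n → Set
Nonempty C = ∃ λ v → 0 ℕ.< C v

IsAlgebraicDesign : ∀ {n d} → SimpleGraph n → (Fin (suc d) → ℝ) → ℕ → Multiset n → Set
IsAlgebraicDesign {n} {d} G θ t C = ∃ λ (φ : Fin (suc d) → Fin n → ℂ) →
  (∀ i → InEigenspace (adjacencyMatrix G) (θ i) (φ i)) ×
  (∀ v → ofReal (fromℕ (C v)) ≈ᶜ sumᶜ (λ i → φ i v)) ×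
  (∀ i → 1 ℕ.≤ toℕ i → toℕ i ℕ.≤ t → ∀ v → φ i v ≈ᶜ 0ᶜ)

-- The value at x of α₁ K⁽¹⁾ + ⋯ + α_d K⁽ᵈ⁾; α i stands for α_{i+1}.
combination : ∀ {d} → (Fin d → ℝ) → ((i : Fin (suc d)) → Polynomial (toℕ i)) → ℝ → ℝ
combination α K x = sum (λ i → α i * eval (K (suc i)) x)

-- max {f (t+1), …, f d} for t < d; since d is one of the indices, f d may start the fold.
maxAfter : ∀ {d} → ℕ → (Fin (suc d) → ℝ) → ℝ
maxAfter {d} t f = foldr _⊔_ (f (Fin.fromℕ d)) (map f (filter (λ i → t ℕ.<? toℕ i) (allFin (suc d))))

{-# OPTIONS --safe #-}
module Submission where

-- Let f be the multiplicity function of C and ψ₀ + ⋯ + ψ_d its decomposition into real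
-- eigenvectors. The matrix P(A) = Σ αᵢ A⁽ⁱ⁾ has nonnegative entries, so the eigenvectors being
-- orthogonal,
--   0 ≤ ⟨f, P(A) f⟩ = P(k) ∥ψ₀∥² + Σ_{i>t} P(θᵢ) ∥ψᵢ∥² ≤ (P(k) − μ) ∥ψ₀∥² + μ ∥f∥².
-- Here ψ₀ is constant, which gives |V| ∥ψ₀∥² = |C|², and ∥f∥² ≥ |C| since multiplicities are
-- natural numbers. As μ < 0, dividing 0 ≤ (P(k) − μ) |C|² / |V| + μ |C| by |C| gives the bound.

open import Defs
open import Algebra.Bundles using (CommutativeRing)
open import Data.Bool.Base using (if_then_else_)
open import Data.Fin.Base as Fin using (Fin; zero; suc; toℕ)
import Data.Fin.Properties as Fin
open import Data.Integer.Base as ℤ using (+_)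
import Data.Integer.Properties as ℤ
open import Data.List.Base using (_∷_; map; foldr; filter; length; tabulate)
open import Data.List.Membership.Propositional using (_∈_)
open import Data.List.Membership.Propositional.Properties using (∈-filter⁺; ∈-allFin)
open import Data.List.Relation.Unary.Any using (here; there)
open import Data.Nat.Base as ℕ using (ℕ; zero; suc; _∸_; NonZero)
import Data.Nat.Properties as ℕ
open import Data.Product.Base using (Σ; _,_; proj₁)
open import Data.Rational.Base as ℚ using (0ℚ; 1ℚ; ½)
import Data.Rational.Properties as ℚ
open import Data.Rational.Solver using (module +-*-Solver)
import Data.Rational.Unnormalised.Base as ℚᵘ
import Data.Rational.Unnormalised.Properties as ℚᵘ
open import Data.Sum.Base using (inj₁; inj₂)
open import Function.Base using (_∘_)
open import Level using (0ℓ)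
open import Relation.Binary.Bundles using (Poset)
open import Relation.Binary.Definitions using (tri<; tri≈; tri>)
open import Relation.Binary.PropositionalEquality as ≡ using (_≡_; _≢_; subst; subst₂)
open import Relation.Binary.Structures using (IsEquivalence)
open import Relation.Nullary.Decidable using (Dec; yes; no; does; dec-true; dec-false; toWitness)
open import Relation.Nullary.Negation using (¬_; contradiction)

open Estimates
open InverseEstimates
open +-*-Solver using (solve; _:=_; _:+_; _:*_; _:-_; :-_)

-- Order and ring structure of the Cauchy reals.

-- The operations act termwise on representatives, so a ring identity over the reals reduces to one
-- over the rationals, which the ring solver settles.
termwise : ∀ {x y} → (∀ n → seq x n ≡ seq y n) → x ≈ y
termwise {x} {y} x≡y = mk≈ λ ε 0<ε → 0 , λ n _ →
  subst (ℚ._< ε)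
    (≡.sym (≡.trans (≡.cong (λ q → ℚ.∣ q ℚ.- seq y n ∣) (x≡y n))
                    (≡.cong ℚ.∣_∣ (ℚ.+-inverseʳ (seq y n)))))
    0<ε

q<q+ε : ∀ q {ε} → 0ℚ ℚ.< ε → q ℚ.< q ℚ.+ ε
q<q+ε q {ε} 0<ε = subst (ℚ._< q ℚ.+ ε) (ℚ.+-identityʳ q) (ℚ.+-monoʳ-< q 0<ε)

termwise-≤ : ∀ {x y} → (∀ n → seq x n ℚ.≤ seq y n) → x ≤ y
termwise-≤ {x} {y} x≤y = mk≤ λ ε 0<ε → 0 , λ n _ → ℚ.≤-<-trans (x≤y n) (q<q+ε (seq y n) 0<ε)

≤-reflexive : ∀ {x y} → x ≈ y → x ≤ y
≤-reflexive {x} {y} (mk≈ close) = mk≤ λ ε 0<ε → let N , h = close ε 0<ε in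
  N , λ n N≤n → ∣∣<⇒< (seq x n) (seq y n) (h n N≤n)

≤-antisym : ∀ {x y} → x ≤ y → y ≤ x → x ≈ y
≤-antisym {x} {y} (mk≤ x≤y) (mk≤ y≤x) = mk≈ λ ε 0<ε →
  let N , h = x≤y ε 0<ε
      M , k = y≤x ε 0<ε
  in N ℕ.⊔ M , λ n ≤n → <⇒∣∣< (seq x n) (seq y n)
       (h n (ℕ.m⊔n≤o⇒m≤o N M ≤n)) (k n (ℕ.m⊔n≤o⇒n≤o N M ≤n))

≤-trans : ∀ {x y z} → x ≤ y → y ≤ z → x ≤ z
≤-trans {x} {y} {z} (mk≤ x≤y) (mk≤ y≤z) = mk≤ λ ε 0<ε →
  let N , h = x≤y (½ ℚ.* ε) (half-pos 0<ε)
      M , k = y≤z (½ ℚ.* ε) (half-pos 0<ε)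
  in N ℕ.⊔ M , λ n ≤n → ℚ.<-trans (h n (ℕ.m⊔n≤o⇒m≤o N M ≤n))
       (subst (seq y n ℚ.+ ½ ℚ.* ε ℚ.<_)
         (≡.trans (ℚ.+-assoc (seq z n) _ _) (≡.cong (seq z n ℚ.+_) (half+half ε)))
         (ℚ.+-monoˡ-< (½ ℚ.* ε) (k n (ℕ.m⊔n≤o⇒n≤o N M ≤n))))

+-mono-≤ : ∀ {x y z w} → x ≤ y → z ≤ w → x + z ≤ y + w
+-mono-≤ {x} {y} {z} {w} (mk≤ x≤y) (mk≤ z≤w) = mk≤ λ ε 0<ε →
  let N , h = x≤y (½ ℚ.* ε) (half-pos 0<ε)
      M , k = z≤w (½ ℚ.* ε) (half-pos 0<ε)
  in N ℕ.⊔ M , λ n ≤n →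
       subst (seq x n ℚ.+ seq z n ℚ.<_)
         (≡.trans
           (solve 3 (λ p q e → (p :+ e) :+ (q :+ e) := (p :+ q) :+ (e :+ e)) ≡.refl
             (seq y n) (seq w n) (½ ℚ.* ε))
           (≡.cong (seq y n ℚ.+ seq w n ℚ.+_) (half+half ε)))
         (ℚ.+-mono-< (h n (ℕ.m⊔n≤o⇒m≤o N M ≤n)) (k n (ℕ.m⊔n≤o⇒n≤o N M ≤n)))

neg-mono-≤ : ∀ {x y} → x ≤ y → - y ≤ - x
neg-mono-≤ {x} {y} (mk≤ x≤y) = mk≤ λ ε 0<ε → let N , h = x≤y ε 0<ε in N , λ n N≤n →
  subst₂ ℚ._<_
    (solve 2 (λ p q → p :+ (:- p :+ :- q) := :- q) ≡.refl (seq x n) (seq y n))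
    (solve 3 (λ p q e → q :+ e :+ (:- p :+ :- q) := :- p :+ e) ≡.refl (seq x n) (seq y n) ε)
    (ℚ.+-monoˡ-< (ℚ.- seq x n ℚ.+ ℚ.- seq y n) (h n N≤n))

≈-isEquivalence : IsEquivalence _≈_
≈-isEquivalence = record
  { refl  = termwise λ _ → ≡.refl
  ; sym   = ≈-sym
  -- Transitivity is inherited from `_≤_` by antisymmetry, sparing another argument with ε/2.
  ; trans = λ x≈y y≈z → ≤-antisym
      (≤-trans (≤-reflexive x≈y) (≤-reflexive y≈z))
      (≤-trans (≤-reflexive (≈-sym y≈z)) (≤-reflexive (≈-sym x≈y)))
  }
  where
  ≈-sym : ∀ {x y} → x ≈ y → y ≈ x
  ≈-sym {x} {y} (mk≈ close) = mk≈ λ ε 0<ε → let N , h = close ε 0<ε in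
    N , λ n N≤n → subst (ℚ._< ε) (∣-∣-swap (seq x n) (seq y n)) (h n N≤n)

≤-poset : Poset 0ℓ 0ℓ 0ℓ
≤-poset = record
  { isPartialOrder = record
    { isPreorder = record
      { isEquivalence = ≈-isEquivalence
      ; reflexive     = ≤-reflexive
      ; trans         = ≤-trans
      }
    ; antisym = ≤-antisym
    }
  }

module ≈ = IsEquivalence ≈-isEquivalence
module ≤ = Poset ≤-poset

-- Write xz - yw = x(z - w) + w(x - y). With eventual bounds A on x and B on w, each summand is
-- eventually smaller than ε/2.
*-cong : ∀ {x y z w} → x ≈ y → z ≈ w → x * z ≈ y * w
*-cong {x} {y} {z} {w} (mk≈ x≈y) (mk≈ z≈w) = mk≈ λ ε 0<ε →
  let A , 0<A , Nx , bx = bounded (seq x) (cauchy x)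
      B , 0<B , Nw , bw = bounded (seq w) (cauchy w)
      δ , 0<δ , Aδ      = share A ε 0<A 0<ε
      η , 0<η , Bη      = share B ε 0<B 0<ε
      N , h             = z≈w δ 0<δ
      M , k             = x≈y η 0<η
  in (Nx ℕ.⊔ Nw) ℕ.⊔ (N ℕ.⊔ M) , λ n ≤n →
  let ≤n₁ = ℕ.m⊔n≤o⇒m≤o (Nx ℕ.⊔ Nw) (N ℕ.⊔ M) ≤n
      ≤n₂ = ℕ.m⊔n≤o⇒n≤o (Nx ℕ.⊔ Nw) (N ℕ.⊔ M) ≤n
  in *-close (seq x n) (seq y n) (seq z n) (seq w n) 0<A 0<B Aδ Bη
       (bx n (ℕ.m⊔n≤o⇒m≤o Nx Nw ≤n₁)) (bw n (ℕ.m⊔n≤o⇒n≤o Nx Nw ≤n₁))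
       (h n (ℕ.m⊔n≤o⇒m≤o N M ≤n₂)) (k n (ℕ.m⊔n≤o⇒n≤o N M ≤n₂))

+-*-commutativeRing : CommutativeRing 0ℓ 0ℓ
+-*-commutativeRing = record
  { Carrier = ℝ
  ; _≈_ = _≈_
  ; _+_ = _+_
  ; _*_ = _*_
  ; -_  = -_
  ; 0#  = 0ℝ
  ; 1#  = 1ℝ
  ; isCommutativeRing = record
    { isRing = record
      { +-isAbelianGroup = record
        { isGroup = record
          { isMonoid = record
            { isSemigroup = record
              { isMagma = record
                { isEquivalence = ≈-isEquivalence
                ; ∙-cong = λ x≈y z≈w → ≤-antisym
                    (+-mono-≤ (≤-reflexive x≈y) (≤-reflexive z≈w))
                    (+-mono-≤ (≤-reflexive (≈.sym x≈y)) (≤-reflexive (≈.sym z≈w)))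
                }
              ; assoc = λ x y z → termwise λ n → ℚ.+-assoc (seq x n) (seq y n) (seq z n)
              }
            ; identity = (λ x → termwise λ n → ℚ.+-identityˡ (seq x n))
                       , (λ x → termwise λ n → ℚ.+-identityʳ (seq x n))
            }
          ; inverse = (λ x → termwise λ n → ℚ.+-inverseˡ (seq x n))
                    , (λ x → termwise λ n → ℚ.+-inverseʳ (seq x n))
          ; ⁻¹-cong = λ x≈y → ≤-antisym
              (neg-mono-≤ (≤-reflexive (≈.sym x≈y))) (neg-mono-≤ (≤-reflexive x≈y))
          }
        ; comm = λ x y → termwise λ n → ℚ.+-comm (seq x n) (seq y n)
        }
      ; *-cong = *-cong
      ; *-assoc = λ x y z → termwise λ n → ℚ.*-assoc (seq x n) (seq y n) (seq z n)
      ; *-identity = (λ x → termwise λ n → ℚ.*-identityˡ (seq x n))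
                   , (λ x → termwise λ n → ℚ.*-identityʳ (seq x n))
      ; distrib = (λ x y z → termwise λ n → ℚ.*-distribˡ-+ (seq x n) (seq y n) (seq z n))
                , (λ x y z → termwise λ n → ℚ.*-distribʳ-+ (seq x n) (seq y n) (seq z n))
      }
    ; *-comm = λ x y → termwise λ n → ℚ.*-comm (seq x n) (seq y n)
    }
  }

open CommutativeRing +-*-commutativeRing
  using (semiring; +-cong; +-congˡ; +-congʳ; *-congˡ; *-congʳ; +-identityˡ; +-identityʳ;
         *-assoc; *-comm; *-identityˡ; *-identityʳ; zeroˡ; zeroʳ; -‿inverseʳ)
open import Algebra.Properties.Semiring.Sum semiring
  using (sum-cong-≋; ∑-comm; *-distribˡ-sum; *-distribʳ-sum; sum-replicate-zero)
import Relation.Binary.Reasoning.Setoid (CommutativeRing.setoid +-*-commutativeRing) as ≈-Reasoning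
import Relation.Binary.Reasoning.PartialOrder ≤-poset as ≤-Reasoning

-- Products, strict order and inverses.

-- A nonnegative real may have negative terms, but eventually none below -ε, so x and 0 both lie
-- below x + ε.
0≤x⇒x≈x⊔0 : ∀ {x} → 0ℝ ≤ x → x ≈ x ⊔ 0ℝ
0≤x⇒x≈x⊔0 {x} (mk≤ 0≤x) = ≤-antisym (termwise-≤ λ n → ℚ.p≤p⊔q (seq x n) 0ℚ)
  (mk≤ λ ε 0<ε → let N , h = 0≤x ε 0<ε in
    N , λ n N≤n → ⊔-<-lub (seq x n) 0ℚ (q<q+ε (seq x n) 0<ε) (h n N≤n))

-- A nonnegative real is x ⊔ 0, and the product of such representatives is nonnegative termwise.
*-nonneg : ∀ {x y} → 0ℝ ≤ x → 0ℝ ≤ y → 0ℝ ≤ x * y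
*-nonneg {x} {y} 0≤x 0≤y =
  ≤-trans (termwise-≤ λ n → ℚ.nonNegative⁻¹ ((seq x n ℚ.⊔ 0ℚ) ℚ.* (seq y n ℚ.⊔ 0ℚ)) {{product n}})
          (≤-reflexive (≈.sym (*-cong (0≤x⇒x≈x⊔0 0≤x) (0≤x⇒x≈x⊔0 0≤y))))
  where
  product : ∀ n → ℚ.NonNegative ((seq x n ℚ.⊔ 0ℚ) ℚ.* (seq y n ℚ.⊔ 0ℚ))
  product n = ℚ.nonNeg*nonNeg⇒nonNeg (seq x n ℚ.⊔ 0ℚ) {{ℚ.nonNegative (ℚ.p≤q⊔p (seq x n) 0ℚ)}}
                                     (seq y n ℚ.⊔ 0ℚ) {{ℚ.nonNegative (ℚ.p≤q⊔p (seq y n) 0ℚ)}}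

x≤y⇒0≤y-x : ∀ {x y} → x ≤ y → 0ℝ ≤ y - x
x≤y⇒0≤y-x {x} {y} x≤y = ≤-trans
  (≤-reflexive (termwise λ n → ≡.sym (ℚ.+-inverseʳ (seq x n))))
  (+-mono-≤ x≤y (≤.refl { - x}))

0≤y-x⇒x≤y : ∀ {x y} → 0ℝ ≤ y - x → x ≤ y
0≤y-x⇒x≤y {x} {y} 0≤y-x = begin
  x            ≈⟨ +-identityʳ x ⟨
  x + 0ℝ       ≤⟨ +-mono-≤ (≤.refl {x}) 0≤y-x ⟩
  x + (y - x)  ≈⟨ termwise (λ n → +-cancel (seq y n) (seq x n)) ⟩
  y            ∎
  where open ≤-Reasoning

*-monoˡ-≤ : ∀ {a x y} → 0ℝ ≤ a → x ≤ y → a * x ≤ a * y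
*-monoˡ-≤ {a} {x} {y} 0≤a x≤y = 0≤y-x⇒x≤y (≤-trans (*-nonneg 0≤a (x≤y⇒0≤y-x x≤y))
  (≤-reflexive (termwise λ n →
    solve 3 (λ a x y → a :* (y :- x) := a :* y :- a :* x) ≡.refl (seq a n) (seq x n) (seq y n))))

<⇒≤ : ∀ {x y} → x < y → x ≤ y
<⇒≤ {x} {y} (mk< g 0<g N h) = mk≤ λ ε 0<ε → N , λ n N≤n →
  ℚ.<-trans (ℚ.<-trans (q<q+ε (seq x n) 0<g) (h n N≤n)) (q<q+ε (seq y n) 0<ε)

-- Half of the gap between x and y absorbs the error allowed by y ≤ z; the other half remains as the
-- gap between x and z.
<-≤-trans : ∀ {x y z} → x < y → y ≤ z → x < z
<-≤-trans {x} {y} {z} (mk< g 0<g N h) (mk≤ y≤z) =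
  let M , k = y≤z (½ ℚ.* g) (half-pos 0<g)
  in mk< (½ ℚ.* g) (half-pos 0<g) (N ℕ.⊔ M) λ n ≤n →
    subst₂ ℚ._<_
      (≡.trans (≡.cong (λ e → seq x n ℚ.+ e ℚ.- ½ ℚ.* g) (≡.sym (half+half g)))
        (solve 2 (λ p e → p :+ (e :+ e) :- e := p :+ e) ≡.refl (seq x n) (½ ℚ.* g)))
      (solve 2 (λ r e → r :+ e :- e := r) ≡.refl (seq z n) (½ ℚ.* g))
      (ℚ.+-monoˡ-< (ℚ.- (½ ℚ.* g))
        (ℚ.<-trans (h n (ℕ.m⊔n≤o⇒m≤o N M ≤n)) (k n (ℕ.m⊔n≤o⇒n≤o N M ≤n))))

x<y⇒0<y-x : ∀ {x y} → x < y → 0ℝ < y - x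
x<y⇒0<y-x {x} {y} (mk< g 0<g N h) = mk< g 0<g N λ n N≤n →
  subst (ℚ._< seq y n ℚ.- seq x n)
    (≡.trans (cancel-+ (seq x n) g) (≡.sym (ℚ.+-identityˡ g)))
    (ℚ.+-monoˡ-< (ℚ.- seq x n) (h n N≤n))

-- Past the index `N` every term exceeds δ > 0, so `invℚ` takes its reciprocal branch and its value
-- is positive.
inv-nonneg : ∀ {x} (0<x : 0ℝ < x) → 0ℝ ≤ inv x (inj₂ 0<x)
inv-nonneg {x} (mk< δ 0<δ N h) = mk≤ λ ε 0<ε → N , λ n N≤n →
  let 0<xₙ = ℚ.<-trans 0<δ (subst (ℚ._< seq x n) (ℚ.+-identityˡ δ) (h n N≤n)) in
  ℚ.<-trans (pos (seq x n) 0<xₙ) (q<q+ε _ 0<ε)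
  where
  pos : ∀ q → 0ℚ ℚ.< q → 0ℚ ℚ.< invℚ q
  pos q 0<q with q ℚ.≟ 0ℚ
  ... | yes q≡0 = contradiction (≡.sym q≡0) (ℚ.<⇒≢ 0<q)
  ... | no  q≢0 = ℚ.positive⁻¹ _ {{ℚ.1/pos⇒pos q {{ℚ.positive 0<q}}}}

inv-inverseˡ : ∀ {x} (0<x : 0ℝ < x) → inv x (inj₂ 0<x) * x ≈ 1ℝ
inv-inverseˡ {x} (mk< δ 0<δ N h) = mk≈ λ ε 0<ε → N , λ n N≤n →
  let 0<xₙ = ℚ.<-trans 0<δ (subst (ℚ._< seq x n) (ℚ.+-identityˡ δ) (h n N≤n)) in
  -- On nonzero terms the product is exactly 1, and the distance of 1 from itself computes to 0.
  subst (λ q → ℚ.∣ q ℚ.- 1ℚ ∣ ℚ.< ε)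
    (≡.sym (invℚ-inverse (seq x n) (λ xₙ≡0 → ℚ.<⇒≢ 0<xₙ (≡.sym xₙ≡0)))) 0<ε

*-cancelˡ-≤ : ∀ {a x y} → 0ℝ < a → a * x ≤ a * y → x ≤ y
*-cancelˡ-≤ {a} {x} {y} 0<a ax≤ay =
  ≤-trans (≤-reflexive (≈.sym (undo x)))
  (≤-trans (*-monoˡ-≤ (inv-nonneg 0<a) ax≤ay) (≤-reflexive (undo y)))
  where
  undo : ∀ z → inv a (inj₂ 0<a) * (a * z) ≈ z
  undo z = begin
    inv a (inj₂ 0<a) * (a * z)  ≈⟨ *-assoc (inv a (inj₂ 0<a)) a z ⟨
    inv a (inj₂ 0<a) * a * z    ≈⟨ *-congʳ (inv-inverseˡ 0<a) ⟩
    1ℝ * z                      ≈⟨ *-identityˡ z ⟩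
    z                           ∎
    where open ≈-Reasoning

*-cancelˡ-≈0 : ∀ {a x} → 0ℝ < a → a * x ≈ 0ℝ → x ≈ 0ℝ
*-cancelˡ-≈0 {a} 0<a ax≈0 = ≤-antisym
  (*-cancelˡ-≤ 0<a (≤-reflexive (≈.trans ax≈0 (≈.sym (zeroʳ a)))))
  (*-cancelˡ-≤ 0<a (≤-reflexive (≈.trans (zeroʳ a) (≈.sym ax≈0))))

x²-nonneg : ∀ x → 0ℝ ≤ x * x
x²-nonneg x = termwise-≤ λ n → square (seq x n)
  where
  square : ∀ q → 0ℚ ℚ.≤ q ℚ.* q
  square q with ℚ.≤-total 0ℚ q
  ... | inj₁ 0≤q = ℚ.nonNegative⁻¹ (q ℚ.* q)
    {{ℚ.nonNeg*nonNeg⇒nonNeg q {{ℚ.nonNegative 0≤q}} q {{ℚ.nonNegative 0≤q}}}}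
  ... | inj₂ q≤0 = ℚ.nonNegative⁻¹ (q ℚ.* q)
    {{ℚ.nonPos*nonPos⇒nonPos q {{ℚ.nonPositive q≤0}} q {{ℚ.nonPositive q≤0}}}}

0≤1 : 0ℝ ≤ 1ℝ
0≤1 = termwise-≤ λ _ → ℚ.nonNegative⁻¹ 1ℚ

x≤x⊔y : ∀ x y → x ≤ x ⊔ y
x≤x⊔y x y = termwise-≤ λ n → ℚ.p≤p⊔q (seq x n) (seq y n)

y≤x⊔y : ∀ x y → y ≤ x ⊔ y
y≤x⊔y x y = termwise-≤ λ n → ℚ.p≤q⊔p (seq x n) (seq y n)

-- Natural numbers and fractions as reals.

-- Normalisation of fractions involves a gcd that does not reduce on variables, so the identity is
-- checked on unnormalised fractions with denominator 1.
/1-+ : ∀ m n → (+ (m ℕ.+ n)) ℚ./ 1 ≡ (+ m) ℚ./ 1 ℚ.+ (+ n) ℚ./ 1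
/1-+ m n = ℚ.toℚᵘ-injective (begin-equality
  ℚ.toℚᵘ ((+ (m ℕ.+ n)) ℚ./ 1)                            ≃⟨ ℚ.toℚᵘ-fromℚᵘ (ℚᵘ.mkℚᵘ (+ (m ℕ.+ n)) 0) ⟩
  ℚᵘ.mkℚᵘ (+ (m ℕ.+ n)) 0                                 ≃⟨ ℚᵘ.*≡* (≡.cong (ℤ._* (+ 1)) numerators) ⟩
  ℚᵘ.mkℚᵘ (+ m) 0 ℚᵘ.+ ℚᵘ.mkℚᵘ (+ n) 0
    ≃⟨ ℚᵘ.+-cong (ℚ.toℚᵘ-fromℚᵘ (ℚᵘ.mkℚᵘ (+ m) 0)) (ℚ.toℚᵘ-fromℚᵘ (ℚᵘ.mkℚᵘ (+ n) 0)) ⟨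
  ℚ.toℚᵘ ((+ m) ℚ./ 1) ℚᵘ.+ ℚ.toℚᵘ ((+ n) ℚ./ 1)          ≃⟨ ℚ.toℚᵘ-homo-+ ((+ m) ℚ./ 1) ((+ n) ℚ./ 1) ⟨
  ℚ.toℚᵘ ((+ m) ℚ./ 1 ℚ.+ (+ n) ℚ./ 1)                    ∎)
  where
  open ℚᵘ.≤-Reasoning
  numerators : + (m ℕ.+ n) ≡ + m ℤ.* + 1 ℤ.+ + n ℤ.* + 1
  numerators = ≡.sym (≡.cong₂ ℤ._+_ (ℤ.*-identityʳ (+ m)) (ℤ.*-identityʳ (+ n)))

fromℕ-+ : ∀ m n → fromℕ (m ℕ.+ n) ≈ fromℕ m + fromℕ n
fromℕ-+ m n = termwise λ _ → /1-+ m n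

-- The one property of the quotient |C|/|V| on which the final bound relies.
fromℚ-/-*-fromℕ : ∀ m n .{{_ : NonZero n}} → fromℚ ((+ m) ℚ./ n) * fromℕ n ≈ fromℕ m
fromℚ-/-*-fromℕ m n@(suc n-1) = termwise λ _ → ℚ.toℚᵘ-injective (begin-equality
  ℚ.toℚᵘ ((+ m) ℚ./ n ℚ.* ((+ n) ℚ./ 1))          ≃⟨ ℚ.toℚᵘ-homo-* ((+ m) ℚ./ n) ((+ n) ℚ./ 1) ⟩
  ℚ.toℚᵘ ((+ m) ℚ./ n) ℚᵘ.* ℚ.toℚᵘ ((+ n) ℚ./ 1)
    ≃⟨ ℚᵘ.*-cong (ℚ.toℚᵘ-fromℚᵘ (ℚᵘ.mkℚᵘ (+ m) n-1)) (ℚ.toℚᵘ-fromℚᵘ (ℚᵘ.mkℚᵘ (+ n) 0)) ⟩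
  ℚᵘ.mkℚᵘ (+ m) n-1 ℚᵘ.* ℚᵘ.mkℚᵘ (+ n) 0          ≃⟨ ℚᵘ.*≡* crossProducts ⟩
  ℚᵘ.mkℚᵘ (+ m) 0                                 ≃⟨ ℚ.toℚᵘ-fromℚᵘ (ℚᵘ.mkℚᵘ (+ m) 0) ⟨
  ℚ.toℚᵘ ((+ m) ℚ./ 1)                            ∎)
  where
  open ℚᵘ.≤-Reasoning
  crossProducts : (+ m ℤ.* + n) ℤ.* + 1 ≡ + m ℤ.* + (n ℕ.* 1)
  crossProducts = ≡.trans (ℤ.*-identityʳ _) (≡.cong (λ k → + m ℤ.* + k) (≡.sym (ℕ.*-identityʳ n)))

fromℕ-nonneg : ∀ n → 0ℝ ≤ fromℕ n
fromℕ-nonneg zero    = ≤.refl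
fromℕ-nonneg (suc n) = begin
  0ℝ            ≤⟨ fromℕ-nonneg n ⟩
  fromℕ n       ≈⟨ +-identityˡ (fromℕ n) ⟨
  0ℝ + fromℕ n  ≤⟨ +-mono-≤ 0≤1 (≤.refl {fromℕ n}) ⟩
  1ℝ + fromℕ n  ≈⟨ fromℕ-+ 1 n ⟨
  fromℕ (suc n) ∎
  where open ≤-Reasoning

1≤fromℕ-suc : ∀ n → 1ℝ ≤ fromℕ (suc n)
1≤fromℕ-suc n = ≤-trans (≤-reflexive (≈.sym (+-identityʳ 1ℝ)))
  (≤-trans (+-mono-≤ (≤.refl {1ℝ}) (fromℕ-nonneg n)) (≤-reflexive (≈.sym (fromℕ-+ 1 n))))

fromℕ-pos : ∀ n .{{_ : NonZero n}} → 0ℝ < fromℕ n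
fromℕ-pos (suc n) =
  -- The gap ½ witnesses 0 < 1, by evaluation of a closed comparison.
  <-≤-trans (mk< ½ (ℚ.positive⁻¹ ½) 0 λ _ _ → toWitness {a? = 0ℚ ℚ.+ ½ ℚ.<? 1ℚ} _) (1≤fromℕ-suc n)

-- Integrality of multiplicities is used here: a natural number is zero or at least 1.
fromℕ≤fromℕ² : ∀ n → fromℕ n ≤ fromℕ n * fromℕ n
fromℕ≤fromℕ² zero    = x²-nonneg (fromℕ 0)
fromℕ≤fromℕ² (suc n) = ≤-trans (≤-reflexive (≈.sym (*-identityʳ _)))
  (*-monoˡ-≤ (fromℕ-nonneg (suc n)) (1≤fromℕ-suc n))

*-antimonoˡ-≤ : ∀ {a x y} → a ≤ 0ℝ → x ≤ y → a * y ≤ a * x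
*-antimonoˡ-≤ {a} {x} {y} a≤0 x≤y = 0≤y-x⇒x≤y (≤-trans (*-nonneg 0≤-a (x≤y⇒0≤y-x x≤y))
  (≤-reflexive (termwise λ n →
    solve 3 (λ a x y → (:- a) :* (y :- x) := a :* x :- a :* y) ≡.refl (seq a n) (seq x n) (seq y n))))
  where
  0≤-a : 0ℝ ≤ - a
  0≤-a = ≤-trans (≤-reflexive {0ℝ} { - 0ℝ} (termwise λ _ → ≡.refl)) (neg-mono-≤ a≤0)

-- Finite sums and indicators.

sum-mono-≤ : ∀ {n} {x y : Fin n → ℝ} → (∀ i → x i ≤ y i) → sum x ≤ sum y
sum-mono-≤ {zero}  x≤y = ≤.refl
sum-mono-≤ {suc n} x≤y = +-mono-≤ (x≤y zero) (sum-mono-≤ (x≤y ∘ suc))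

sum-zero : ∀ {n} {x : Fin n → ℝ} → (∀ i → x i ≈ 0ℝ) → sum x ≈ 0ℝ
sum-zero {n} x≈0 = ≈.trans (sum-cong-≋ x≈0) (sum-replicate-zero n)

sum-nonneg : ∀ {n} {x : Fin n → ℝ} → (∀ i → 0ℝ ≤ x i) → 0ℝ ≤ sum x
sum-nonneg {n} 0≤x = ≤-trans (≤-reflexive (≈.sym (sum-replicate-zero n))) (sum-mono-≤ 0≤x)

sum-single : ∀ {n} {x : Fin n → ℝ} i → (∀ j → j ≢ i → x j ≈ 0ℝ) → sum x ≈ x i
sum-single {x = x} zero x≈0 =
  ≈.trans (+-congˡ (sum-zero (λ j → x≈0 (suc j) λ ()))) (+-identityʳ (x zero))
sum-single {x = x} (suc i) x≈0 =
  ≈.trans (+-cong (x≈0 zero λ ()) (sum-single i λ j j≢i → x≈0 (suc j) (j≢i ∘ Fin.suc-injective)))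
          (+-identityˡ (x (suc i)))

indicator-true : ∀ {P : Set} (P? : Dec P) → P → (if does P? then 1ℝ else 0ℝ) ≡ 1ℝ
indicator-true P? p = ≡.cong (if_then 1ℝ else 0ℝ) (dec-true P? p)

indicator-false : ∀ {P : Set} (P? : Dec P) → ¬ P → (if does P? then 1ℝ else 0ℝ) ≡ 0ℝ
indicator-false P? ¬p = ≡.cong (if_then 1ℝ else 0ℝ) (dec-false P? ¬p)

indicator-nonneg : ∀ {P : Set} (P? : Dec P) → 0ℝ ≤ (if does P? then 1ℝ else 0ℝ)
indicator-nonneg (yes _) = 0≤1
indicator-nonneg (no _)  = ≤.refl

-- Inner products and eigenvectors of real matrices.

infixl 7 _·_

_·_ : ∀ {n} → Matrix n → (Fin n → ℝ) → Fin n → ℝ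
(M · ψ) u = sum (λ v → M u v * ψ v)

-- Definitionally `(M · ψ) u` is `⟨ M u , ψ ⟩`, so the rules for this bilinear form also serve for
-- matrix-vector products.
⟨_,_⟩ : ∀ {n} → (Fin n → ℝ) → (Fin n → ℝ) → ℝ
⟨ φ , ψ ⟩ = sum (λ v → φ v * ψ v)

record IsEigenvector {n} (M : Matrix n) (θ : ℝ) (ψ : Fin n → ℝ) : Set where
  field
    scales : ∀ u → (M · ψ) u ≈ θ * ψ u

open IsEigenvector

-- Common form of three matrices: a polynomial in A, to which `evalᴹ` unfolds, the matrix P(A), and
-- the all-ones matrix as a sum of distance matrices.
linearCombination : ∀ {n m} → (Fin m → ℝ) → (Fin m → Matrix n) → Matrix n
linearCombination c M u v = sum (λ j → c j * M j u v)

⟨,⟩-comm : ∀ {n} (φ ψ : Fin n → ℝ) → ⟨ φ , ψ ⟩ ≈ ⟨ ψ , φ ⟩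
⟨,⟩-comm φ ψ = sum-cong-≋ λ v → *-comm (φ v) (ψ v)

⟨,⟩-scaleˡ : ∀ {n} a (φ ψ : Fin n → ℝ) → ⟨ (λ v → a * φ v) , ψ ⟩ ≈ a * ⟨ φ , ψ ⟩
⟨,⟩-scaleˡ a φ ψ = ≈.trans (sum-cong-≋ λ v → *-assoc a (φ v) (ψ v))
                           (≈.sym (*-distribˡ-sum a (λ v → φ v * ψ v)))

⟨,⟩-scaleʳ : ∀ {n} a (φ ψ : Fin n → ℝ) → ⟨ φ , (λ v → a * ψ v) ⟩ ≈ a * ⟨ φ , ψ ⟩
⟨,⟩-scaleʳ a φ ψ = ≈.trans (⟨,⟩-comm φ (λ v → a * ψ v))
  (≈.trans (⟨,⟩-scaleˡ a ψ φ) (*-congˡ (⟨,⟩-comm ψ φ)))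

⟨sum,⟩ : ∀ {n m} (φ : Fin m → Fin n → ℝ) (ψ : Fin n → ℝ) →
         ⟨ (λ v → sum (λ j → φ j v)) , ψ ⟩ ≈ sum (λ j → ⟨ φ j , ψ ⟩)
⟨sum,⟩ φ ψ = ≈.trans (sum-cong-≋ λ v → *-distribʳ-sum (ψ v) (λ j → φ j v))
                     (∑-comm (λ v j → φ j v * ψ v))

⟨,sum⟩ : ∀ {n m} (φ : Fin n → ℝ) (ψ : Fin m → Fin n → ℝ) →
         ⟨ φ , (λ v → sum (λ j → ψ j v)) ⟩ ≈ sum (λ j → ⟨ φ , ψ j ⟩)
⟨,sum⟩ φ ψ = ≈.trans (⟨,⟩-comm φ (λ v → sum (λ j → ψ j v)))
  (≈.trans (⟨sum,⟩ ψ φ) (sum-cong-≋ λ j → ⟨,⟩-comm (ψ j) φ))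

⟨,⟩-congˡ : ∀ {n} {φ ψ χ : Fin n → ℝ} → (∀ v → ψ v ≈ χ v) → ⟨ φ , ψ ⟩ ≈ ⟨ φ , χ ⟩
⟨,⟩-congˡ ψ≈χ = sum-cong-≋ λ v → *-congˡ (ψ≈χ v)

⟨,⟩-congʳ : ∀ {n} {φ ψ χ : Fin n → ℝ} → (∀ v → ψ v ≈ χ v) → ⟨ ψ , φ ⟩ ≈ ⟨ χ , φ ⟩
⟨,⟩-congʳ ψ≈χ = sum-cong-≋ λ v → *-congʳ (ψ≈χ v)

module _ {n : ℕ} where

  private variable
    M N : Matrix n
    a b : ℝ
    φ ψ : Fin n → ℝ

  IsEigenvector-cong : M ≈ᴹ N → a ≈ b → IsEigenvector M a ψ → IsEigenvector N b ψ
  IsEigenvector-cong {ψ = ψ} M≈N a≈b Mψ .scales u =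
    ≈.trans (⟨,⟩-congʳ {φ = ψ} λ v → ≈.sym (M≈N u v)) (≈.trans (Mψ .scales u) (*-congʳ a≈b))

  identity-eigenvector : ∀ ψ → IsEigenvector (identity {n}) 1ℝ ψ
  identity-eigenvector ψ .scales u = ≈.trans
    (sum-single u λ v v≢u → ≈.trans
      (*-congʳ (≈.reflexive (indicator-false (u Fin.≟ v) (v≢u ∘ ≡.sym)))) (zeroˡ (ψ v)))
    (*-congʳ (≈.reflexive (indicator-true (u Fin.≟ u) ≡.refl)))

  *ᴹ-eigenvector : IsEigenvector M a ψ → IsEigenvector N b ψ → IsEigenvector (M *ᴹ N) (a * b) ψ
  *ᴹ-eigenvector {M} {a} {ψ} {N} {b} Mψ Nψ .scales u = begin
    -- The first two steps are associativity, (MN)ψ = M(Nψ).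
    ⟨ (λ v → sum (λ w → M u w * N w v)) , ψ ⟩  ≈⟨ ⟨sum,⟩ (λ w v → M u w * N w v) ψ ⟩
    sum (λ w → ⟨ (λ v → M u w * N w v) , ψ ⟩)  ≈⟨ sum-cong-≋ (λ w → ⟨,⟩-scaleˡ (M u w) (N w) ψ) ⟩
    ⟨ M u , N · ψ ⟩                            ≈⟨ ⟨,⟩-congˡ {φ = M u} (Nψ .scales) ⟩
    ⟨ M u , (λ w → b * ψ w) ⟩                  ≈⟨ ⟨,⟩-scaleʳ b (M u) ψ ⟩
    b * (M · ψ) u                              ≈⟨ *-congˡ (Mψ .scales u) ⟩
    b * (a * ψ u)                              ≈⟨ *-assoc b a (ψ u) ⟨
    b * a * ψ u                                ≈⟨ *-congʳ (*-comm b a) ⟩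
    a * b * ψ u                                ∎
    where open ≈-Reasoning

  ^ᴹ-eigenvector : ∀ j → IsEigenvector M a ψ → IsEigenvector (M ^ᴹ j) (a ^ j) ψ
  ^ᴹ-eigenvector {ψ = ψ} zero    Mψ = identity-eigenvector ψ
  ^ᴹ-eigenvector (suc j) Mψ =
    *ᴹ-eigenvector Mψ (^ᴹ-eigenvector j Mψ)

  linearCombination-eigenvector :
    ∀ {m} (c : Fin m → ℝ) {M : Fin m → Matrix n} {θ : Fin m → ℝ} →
    (∀ j → IsEigenvector (M j) (θ j) ψ) →
    IsEigenvector (linearCombination c M) (sum (λ j → c j * θ j)) ψ
  linearCombination-eigenvector {ψ} c {M} {θ} Mψ .scales u = begin
    ⟨ (λ v → sum (λ j → c j * M j u v)) , ψ ⟩  ≈⟨ ⟨sum,⟩ (λ j v → c j * M j u v) ψ ⟩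
    sum (λ j → ⟨ (λ v → c j * M j u v) , ψ ⟩)  ≈⟨ sum-cong-≋ (λ j → ⟨,⟩-scaleˡ (c j) (M j u) ψ) ⟩
    sum (λ j → c j * (M j · ψ) u)              ≈⟨ sum-cong-≋ (λ j → *-congˡ (Mψ j .scales u)) ⟩
    sum (λ j → c j * (θ j * ψ u))              ≈⟨ sum-cong-≋ (λ j → *-assoc (c j) (θ j) (ψ u)) ⟨
    sum (λ j → c j * θ j * ψ u)                ≈⟨ *-distribʳ-sum (ψ u) (λ j → c j * θ j) ⟨
    sum (λ j → c j * θ j) * ψ u                ∎
    where open ≈-Reasoning

  evalᴹ-eigenvector : ∀ {m} (p : Polynomial m) →
    IsEigenvector M a ψ → IsEigenvector (evalᴹ p M) (eval p a) ψ
  evalᴹ-eigenvector p Mψ = linearCombination-eigenvector (coeff p) λ j → ^ᴹ-eigenvector (toℕ j) Mψ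

  -- Symmetry moves M across the inner product: a⟨φ,ψ⟩ = ⟨Mφ,ψ⟩ = ⟨φ,Mψ⟩ = b⟨φ,ψ⟩. The strict
  -- inequality makes a - b a positive factor, which can be cancelled.
  eigenvectors-orthogonal : (∀ u v → M u v ≈ M v u) → IsEigenvector M a φ → IsEigenvector M b ψ →
    b < a → ⟨ φ , ψ ⟩ ≈ 0ℝ
  eigenvectors-orthogonal {M} {a} {φ} {b} {ψ} M-sym Mφ Mψ b<a =
    *-cancelˡ-≈0 (x<y⇒0<y-x b<a) (begin
      (a - b) * ⟨ φ , ψ ⟩              ≈⟨ distrib-- a b ⟨ φ , ψ ⟩ ⟩
      a * ⟨ φ , ψ ⟩ - b * ⟨ φ , ψ ⟩    ≈⟨ +-congʳ a⟨φ,ψ⟩≈b⟨φ,ψ⟩ ⟩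
      b * ⟨ φ , ψ ⟩ - b * ⟨ φ , ψ ⟩    ≈⟨ -‿inverseʳ (b * ⟨ φ , ψ ⟩) ⟩
      0ℝ                               ∎)
    where
    open ≈-Reasoning

    distrib-- : ∀ x y z → (x - y) * z ≈ x * z - y * z
    distrib-- x y z = termwise λ n →
      solve 3 (λ x y z → (x :- y) :* z := x :* z :- y :* z) ≡.refl (seq x n) (seq y n) (seq z n)

    transpose : ∀ v u → M u v * φ v ≈ φ v * M v u
    transpose v u = ≈.trans (*-comm (M u v) (φ v)) (*-congˡ (M-sym u v))

    a⟨φ,ψ⟩≈b⟨φ,ψ⟩ : a * ⟨ φ , ψ ⟩ ≈ b * ⟨ φ , ψ ⟩
    a⟨φ,ψ⟩≈b⟨φ,ψ⟩ = begin
      a * ⟨ φ , ψ ⟩                              ≈⟨ ⟨,⟩-scaleˡ a φ ψ ⟨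
      ⟨ (λ u → a * φ u) , ψ ⟩                    ≈⟨ ⟨,⟩-congʳ {φ = ψ} (Mφ .scales) ⟨
      ⟨ (λ u → sum (λ v → M u v * φ v)) , ψ ⟩    ≈⟨ ⟨sum,⟩ (λ v u → M u v * φ v) ψ ⟩
      sum (λ v → ⟨ (λ u → M u v * φ v) , ψ ⟩)    ≈⟨ sum-cong-≋ (λ v → ⟨,⟩-congʳ {φ = ψ} (transpose v)) ⟩
      sum (λ v → ⟨ (λ u → φ v * M v u) , ψ ⟩)    ≈⟨ sum-cong-≋ (λ v → ⟨,⟩-scaleˡ (φ v) (M v) ψ) ⟩
      ⟨ φ , M · ψ ⟩                              ≈⟨ ⟨,⟩-congˡ {φ = φ} (Mψ .scales) ⟩
      ⟨ φ , (λ u → b * ψ u) ⟩                    ≈⟨ ⟨,⟩-scaleʳ b φ ψ ⟩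
      b * ⟨ φ , ψ ⟩                              ∎

-- Cardinalities, counting, maxima and real parts.

fromℕ-sum : ∀ {n} (C : Multiset n) → fromℕ (cardinality C) ≈ sum (fromℕ ∘ C)
fromℕ-sum {zero}  C = ≈.refl
fromℕ-sum {suc n} C =
  ≈.trans (fromℕ-+ (C zero) (cardinality (C ∘ suc))) (+-congˡ (fromℕ-sum (C ∘ suc)))

sum-ones : ∀ n → sum {n} (λ _ → 1ℝ) ≈ fromℕ n
sum-ones zero    = ≈.refl
sum-ones (suc n) = ≈.trans (+-congˡ (sum-ones n)) (≈.sym (fromℕ-+ 1 n))

nonempty⇒cardinality≢0 : ∀ {n} {C : Multiset n} → Nonempty C → NonZero (cardinality C)
nonempty⇒cardinality≢0 {C = C} (v , 0<C) = ℕ.>-nonZero (ℕ.<-≤-trans 0<C (C≤cardinality C v))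
  where
  C≤cardinality : ∀ {n} (C : Multiset n) v → C v ℕ.≤ cardinality C
  C≤cardinality C zero    = ℕ.m≤m+n (C zero) _
  C≤cardinality C (suc v) = ℕ.≤-trans (C≤cardinality (C ∘ suc) v) (ℕ.m≤n+m _ (C zero))

-- Stated for `tabulate f` so that the induction can pass to `f ∘ suc`; with the identity for f it
-- turns a vertex degree into a row sum of A.
fromℕ-count : ∀ {A : Set} {P : A → Set} (P? : ∀ x → Dec (P x)) {n} (f : Fin n → A) →
  fromℕ (length (filter P? (tabulate f))) ≈ sum (λ i → if does (P? (f i)) then 1ℝ else 0ℝ)
fromℕ-count P? {zero}  f = ≈.refl
fromℕ-count P? {suc n} f with P? (f zero)
... | yes _ = ≈.trans (fromℕ-+ 1 (length (filter P? (tabulate (f ∘ suc)))))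
                      (+-congˡ (fromℕ-count P? (f ∘ suc)))
... | no  _ = ≈.trans (fromℕ-count P? (f ∘ suc)) (≈.sym (+-identityˡ _))

maxAfter-upper : ∀ {d} t (f : Fin (suc d) → ℝ) i → t ℕ.< toℕ i → f i ≤ maxAfter t f
maxAfter-upper t f i t<i = foldr-⊔-upper _ (∈-filter⁺ (λ i → t ℕ.<? toℕ i) (∈-allFin i) t<i)
  where
  foldr-⊔-upper : ∀ e {xs} → i ∈ xs → f i ≤ foldr _⊔_ e (map f xs)
  foldr-⊔-upper e {_ ∷ xs} (here ≡.refl) = x≤x⊔y (f i) (foldr _⊔_ e (map f xs))
  foldr-⊔-upper e {x ∷ xs} (there i∈xs)  =
    ≤-trans (foldr-⊔-upper e i∈xs) (y≤x⊔y (f x) (foldr _⊔_ e (map f xs)))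

re-sumᶜ : ∀ {n} (z : Fin n → ℂ) → re (sumᶜ z) ≡ sum (re ∘ z)
re-sumᶜ {zero}  z = ≡.refl
re-sumᶜ {suc n} z = ≡.cong (λ x → re (z zero) + x) (re-sumᶜ (z ∘ suc))

-- Matrix and eigenvalue are real, so real parts satisfy the same equations. As multiplicities are
-- real too, the complex decomposition of f can be replaced by the real parts of its components.
re-eigenvector : ∀ {n} {M : Matrix n} {θ φ} → InEigenspace M θ φ → IsEigenvector M θ (re ∘ φ)
re-eigenvector {M = M} {φ = φ} Mφ .scales u =
  ≈.trans (≈.reflexive (≡.sym (re-sumᶜ (λ v → M u v • φ v)))) (proj₁ (Mφ u))

-- Adjacency and distance matrices of a graph.

module _ {n} (G : SimpleGraph n) where
  open SimpleGraph G

  private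
    A : Matrix n
    A = adjacencyMatrix G

  adjacencyMatrix-sym : ∀ u v → A u v ≈ A v u
  adjacencyMatrix-sym u v with u ~? v
  ... | yes u~v = ≈.reflexive (≡.sym (indicator-true (v ~? u) (~-sym u~v)))
  ... | no  u≁v = ≈.reflexive (≡.sym (indicator-false (v ~? u) (u≁v ∘ ~-sym)))

  ones-eigenvector : ∀ {k} → IsRegular G k → IsEigenvector A (fromℕ k) (λ _ → 1ℝ)
  ones-eigenvector {k} regular .scales u = begin
    sum (λ v → A u v * 1ℝ)  ≈⟨ sum-cong-≋ (λ v → *-identityʳ (A u v)) ⟩
    sum (A u)               ≈⟨ fromℕ-count (u ~?_) (λ v → v) ⟨
    fromℕ (degree G u)      ≡⟨ ≡.cong fromℕ (regular u) ⟩
    fromℕ k                 ≈⟨ *-identityʳ (fromℕ k) ⟨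
    fromℕ k * 1ℝ            ∎
    where open ≈-Reasoning

  distanceMatrix-nonneg : ∀ j u v → 0ℝ ≤ distanceMatrix G j u v
  distanceMatrix-nonneg zero      u v = indicator-nonneg (u Fin.≟ v)
  distanceMatrix-nonneg j@(suc _) u v = indicator-nonneg (isDistance? G j u v)

  distanceMatrix-distance : ∀ j {u v} → IsDistance G j u v → distanceMatrix G j u v ≡ 1ℝ
  distanceMatrix-distance zero      {u} {v} (u≡v , _) = indicator-true (u Fin.≟ v) u≡v
  distanceMatrix-distance j@(suc _) {u} {v} dist      = indicator-true (isDistance? G j u v) dist

  distanceMatrix-otherwise : ∀ j {u v} → ¬ IsDistance G j u v → distanceMatrix G j u v ≡ 0ℝ
  distanceMatrix-otherwise zero      {u} {v} ¬dist = indicator-false (u Fin.≟ v) λ u≡v → ¬dist (u≡v , λ ())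
  distanceMatrix-otherwise j@(suc _) {u} {v} ¬dist = indicator-false (isDistance? G j u v) ¬dist

  distance-unique : ∀ {i j u v} → IsDistance G i u v → IsDistance G j u v → i ≡ j
  distance-unique {i} {j} (walkᵢ , minᵢ) (walkⱼ , minⱼ) with ℕ.<-cmp i j
  ... | tri< i<j _ _ = contradiction walkᵢ (minⱼ i<j)
  ... | tri≈ _ i≡j _ = i≡j
  ... | tri> _ _ j<i = contradiction walkⱼ (minᵢ j<i)

  -- Any two vertices have exactly one distance, and it is at most d, so a single summand is 1 and
  -- the others vanish.
  distanceMatrix-sum : ∀ {d} → IsDiameter G d → ∀ u v →
    sum {suc d} (λ i → distanceMatrix G (toℕ i) u v) ≈ 1ℝ
  distanceMatrix-sum {d} (distance , _) u v with distance u v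
  ... | j , j≤d , dist = ≈.trans
    (sum-single i λ i′ i′≢i → ≈.reflexive (distanceMatrix-otherwise (toℕ i′) λ dist′ →
      i′≢i (Fin.toℕ-injective (distance-unique dist′ distᵢ))))
    (≈.reflexive (distanceMatrix-distance (toℕ i) distᵢ))
    where
    i = Fin.fromℕ< (ℕ.s≤s j≤d)
    distᵢ : IsDistance G (toℕ i) u v
    distᵢ = subst (λ j → IsDistance G j u v) (≡.sym (Fin.toℕ-fromℕ< (ℕ.s≤s j≤d))) dist

  module _ {d} (K : (i : Fin (suc d)) → Polynomial (toℕ i))
           (K-spec : ∀ i → distanceMatrix G (toℕ i) ≈ᴹ evalᴹ (K i) A) where

    distanceMatrix-eigenvector : ∀ {a ψ} → IsEigenvector A a ψ →
      ∀ i → IsEigenvector (distanceMatrix G (toℕ i)) (eval (K i) a) ψ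
    distanceMatrix-eigenvector Aψ i =
      IsEigenvector-cong (λ u v → ≈.sym (K-spec i u v)) ≈.refl (evalᴹ-eigenvector (K i) Aψ)

    -- The all-ones matrix is the sum of the distance matrices, hence a polynomial in A; its
    -- eigenvalue at k is read off the all-ones vector to be n.
    valency-eigenvector-constant : ∀ {k ψ} → IsDiameter G d → IsRegular G k →
      IsEigenvector A (fromℕ k) ψ → ∀ u → fromℕ n * ψ u ≈ sum ψ
    valency-eigenvector-constant {k} {ψ} diameter regular Aψ u = begin
      fromℕ n * ψ u      ≈⟨ *-congʳ (sum-ones n) ⟨
      sum ones * ψ u     ≈⟨ *-congʳ (J-eigenvector (ones-eigenvector regular) u) ⟩
      q * 1ℝ * ψ u       ≈⟨ *-congʳ (*-identityʳ q) ⟩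
      q * ψ u            ≈⟨ J-eigenvector Aψ u ⟨
      sum ψ              ∎
      where
      open ≈-Reasoning
      ones : Fin n → ℝ
      ones _ = 1ℝ

      q : ℝ
      q = sum (λ i → 1ℝ * eval (K i) (fromℕ k))

      J≈1 : ∀ u v → linearCombination {m = suc d} (λ _ → 1ℝ) (λ i → distanceMatrix G (toℕ i)) u v ≈ 1ℝ
      J≈1 u v = ≈.trans (sum-cong-≋ {suc d} λ i → *-identityˡ (distanceMatrix G (toℕ i) u v))
                        (distanceMatrix-sum diameter u v)

      J-eigenvector : ∀ {ψ} → IsEigenvector A (fromℕ k) ψ → ∀ u → sum ψ ≈ q * ψ u
      J-eigenvector {ψ} Aψ u = ≈.trans
        (sum-cong-≋ λ v → ≈.trans (≈.sym (*-identityˡ (ψ v))) (*-congʳ {x = ψ v} (≈.sym (J≈1 u v))))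
        (linearCombination-eigenvector (λ _ → 1ℝ) (distanceMatrix-eigenvector Aψ) .scales u)

-- Quadratic forms on a sum of pairwise orthogonal eigenvectors.

module OrthogonalDecomposition {n d} {f : Fin n → ℝ} {ψ : Fin (suc d) → Fin n → ℝ}
  (f≈∑ψ : ∀ v → f v ≈ sum (λ i → ψ i v))
  (orthogonal : ∀ {i j} → i ≢ j → ⟨ ψ i , ψ j ⟩ ≈ 0ℝ) where

  ∥_∥² : (Fin n → ℝ) → ℝ
  ∥ φ ∥² = ⟨ φ , φ ⟩

  ⟨f,ψ⟩ : ∀ i → ⟨ f , ψ i ⟩ ≈ ∥ ψ i ∥²
  ⟨f,ψ⟩ i = ≈.trans (⟨,⟩-congʳ {φ = ψ i} f≈∑ψ)
    (≈.trans (⟨sum,⟩ ψ (ψ i)) (sum-single i λ j j≢i → orthogonal j≢i))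

  parseval : ∥ f ∥² ≈ sum (λ i → ∥ ψ i ∥²)
  parseval = ≈.trans (⟨,⟩-congˡ {φ = f} f≈∑ψ) (≈.trans (⟨,sum⟩ f ψ) (sum-cong-≋ ⟨f,ψ⟩))

  quadratic-form : ∀ {M : Matrix n} {p : Fin (suc d) → ℝ} →
    (∀ i → IsEigenvector M (p i) (ψ i)) → ⟨ f , M · f ⟩ ≈ sum (λ i → p i * ∥ ψ i ∥²)
  quadratic-form {M} {p} Mψ = begin
    ⟨ f , M · f ⟩                              ≈⟨ ⟨,⟩-congˡ {φ = f} M·f ⟩
    ⟨ f , (λ u → sum (λ i → p i * ψ i u)) ⟩    ≈⟨ ⟨,sum⟩ f (λ i u → p i * ψ i u) ⟩
    sum (λ i → ⟨ f , (λ u → p i * ψ i u) ⟩)    ≈⟨ sum-cong-≋ (λ i → ⟨,⟩-scaleʳ (p i) f (ψ i)) ⟩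
    sum (λ i → p i * ⟨ f , ψ i ⟩)              ≈⟨ sum-cong-≋ (λ i → *-congˡ {x = p i} (⟨f,ψ⟩ i)) ⟩
    sum (λ i → p i * ∥ ψ i ∥²)                 ∎
    where
    open ≈-Reasoning
    M·f : ∀ u → (M · f) u ≈ sum (λ i → p i * ψ i u)
    M·f u = ≈.trans (⟨,⟩-congˡ {φ = M u} f≈∑ψ) (≈.trans (⟨,sum⟩ (M u) ψ) (sum-cong-≋ λ i → Mψ i .scales u))

  -- All coefficients but the zeroth are replaced by μ, and Parseval recombines the norms into ∥f∥².
  -- The hypothesis compares products because for 1 ≤ i ≤ t the coefficient may exceed μ while the
  -- norm vanishes.
  quadratic-form-≤ : ∀ {M : Matrix n} {p : Fin (suc d) → ℝ} {μ} →
    (∀ i → IsEigenvector M (p i) (ψ i)) →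
    (∀ i → p (suc i) * ∥ ψ (suc i) ∥² ≤ μ * ∥ ψ (suc i) ∥²) →
    ⟨ f , M · f ⟩ ≤ (p zero - μ) * ∥ ψ zero ∥² + μ * ∥ f ∥²
  quadratic-form-≤ {M} {p} {μ} Mψ p≤μ = begin
    ⟨ f , M · f ⟩
      ≈⟨ quadratic-form {M} {p} Mψ ⟩
    p zero * N₀ + sum (λ i → p (suc i) * N (suc i))
      ≤⟨ +-mono-≤ ≤.refl (sum-mono-≤ p≤μ) ⟩
    p zero * N₀ + sum (λ i → μ * N (suc i))
      ≈⟨ +-congˡ (*-distribˡ-sum μ (N ∘ suc)) ⟨
    p zero * N₀ + μ * sum (N ∘ suc)
      ≈⟨ regroup (p zero) μ N₀ (sum (N ∘ suc)) ⟩
    (p zero - μ) * N₀ + μ * (N₀ + sum (N ∘ suc))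
      ≈⟨ +-congˡ (*-congˡ parseval) ⟨
    (p zero - μ) * N₀ + μ * ∥ f ∥²
      ∎
    where
    open ≤-Reasoning
    N : Fin (suc d) → ℝ
    N i = ∥ ψ i ∥²
    N₀ = N zero

    regroup : ∀ p m x s → p * x + m * s ≈ (p - m) * x + m * (x + s)
    regroup p m x s = termwise λ n →
      solve 4 (λ p m x s → p :* x :+ m :* s := (p :- m) :* x :+ m :* (x :+ s)) ≡.refl
        (seq p n) (seq m n) (seq x n) (seq s n)

-- The bound for algebraic designs.

-- Division requires P(k) - μ to be apart from zero, so the conclusion supplies a proof of this; it
-- comes from μ < 0 ≤ P(k).
lemma18 : ∀ (n : ℕ) .{{_ : NonZero n}} (G : SimpleGraph n) (d k : ℕ) →
    IsDistanceRegular G d → 1 ℕ.≤ d → IsRegular G k →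
    (θ : Fin (suc d) → ℝ) → IsSpectrum G θ → θ zero ≈ fromℕ k →
    (t : ℕ) → t ℕ.≤ d ∸ 1 →
    (K : (i : Fin (suc d)) → Polynomial (toℕ i)) →
    (∀ i → distanceMatrix G (toℕ i) ≈ᴹ evalᴹ (K i) (adjacencyMatrix G)) →
    (α : Fin d → ℝ) → (∀ i → 0ℝ ≤ α i) →
    let P = combination α K
        μ = maxAfter t (λ i → P (θ i))
    in μ < 0ℝ →
    (C : Multiset n) → Nonempty C → IsAlgebraicDesign G θ t C →
    Σ (P (fromℕ k) - μ # 0ℝ) λ nonzero →
      (- μ) ÷ (P (fromℕ k) - μ , nonzero) ≤ fromℚ (+ cardinality C ℚ./ n)
lemma18 n@(suc _) G d k distanceRegular _ regular θ spectrum θ₀≈k t _ K K-spec α α≥0 μ<0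
  C nonempty (φ , φ-eigen , C≈∑φ , φ≈0) =
  inj₂ 0<D ,
    -- Cleared of the denominator D, the claim is -μ ≤ Dc, that is 0 ≤ Dc + μ.
    *-cancelˡ-≤ 0<D (begin
      D * (- μ * D⁻¹)    ≈⟨ rearrange D (- μ) D⁻¹ ⟩
      - μ * (D⁻¹ * D)    ≈⟨ *-congˡ (inv-inverseˡ 0<D) ⟩
      - μ * 1ℝ           ≈⟨ *-identityʳ (- μ) ⟩
      - μ                ≤⟨ 0≤y-x⇒x≤y (≤-trans 0≤Dc+μ (≤-reflexive (+-as-- D c μ))) ⟩
      D * c              ∎)
  where
  open ≤-Reasoning
  open IsDistanceRegular distanceRegular using (diameter)
  open IsSpectrum spectrum using (decreasing)
  A = adjacencyMatrix G
  P = combination α K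
  μ = maxAfter t (λ i → P (θ i))
  D = P (fromℕ k) - μ
  c = fromℚ (+ cardinality C ℚ./ n)
  s = fromℕ (cardinality C)

  f : Fin n → ℝ
  f = fromℕ ∘ C

  ψ : Fin (suc d) → Fin n → ℝ
  ψ i = re ∘ φ i

  -- Index zero uses k itself: `θ zero` is merely `≈` to it, and this choice yields P(k) without a
  -- congruence for P.
  p : Fin (suc d) → ℝ
  p zero    = P (fromℕ k)
  p (suc i) = P (θ (suc i))

  -- This is P(A), built from distance matrices so that its entries are visibly nonnegative. Since
  -- `α i` stands for the coefficient with index i + 1, it multiplies the matrix of distance i + 1.
  PA : Matrix n
  PA = linearCombination α (λ i → distanceMatrix G (suc (toℕ i)))

  PA-eigenvector : ∀ {a χ} → IsEigenvector A a χ → IsEigenvector PA (P a) χ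
  PA-eigenvector Aχ = linearCombination-eigenvector α (λ i →
    distanceMatrix-eigenvector G K K-spec Aχ (suc i))

  PA-nonneg : ∀ u v → 0ℝ ≤ PA u v
  PA-nonneg u v = sum-nonneg λ i → *-nonneg (α≥0 i) (distanceMatrix-nonneg G (suc (toℕ i)) u v)

  ψ-eigenvector : ∀ i → IsEigenvector A (θ i) (ψ i)
  ψ-eigenvector i = re-eigenvector (φ-eigen i)

  ψ₀-eigenvector : IsEigenvector A (fromℕ k) (ψ zero)
  ψ₀-eigenvector = IsEigenvector-cong (λ _ _ → ≈.refl) θ₀≈k (ψ-eigenvector zero)

  ones : Fin n → ℝ
  ones _ = 1ℝ

  PA-ψ : ∀ i → IsEigenvector PA (p i) (ψ i)
  PA-ψ zero    = PA-eigenvector ψ₀-eigenvector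
  PA-ψ (suc i) = PA-eigenvector (ψ-eigenvector (suc i))

  f≈∑ψ : ∀ v → f v ≈ sum (λ i → ψ i v)
  f≈∑ψ v = ≈.trans (proj₁ (C≈∑φ v)) (≈.reflexive (re-sumᶜ (λ i → φ i v)))

  orthogonal : ∀ {i j} → i ≢ j → ⟨ ψ i , ψ j ⟩ ≈ 0ℝ
  orthogonal {i} {j} i≢j with Fin.<-cmp i j
  ... | tri< i<j _ _ = eigenvectors-orthogonal (adjacencyMatrix-sym G)
    (ψ-eigenvector i) (ψ-eigenvector j) (decreasing i<j)
  ... | tri≈ _ i≡j _ = contradiction i≡j i≢j
  ... | tri> _ _ j<i = ≈.trans (⟨,⟩-comm (ψ i) (ψ j)) (eigenvectors-orthogonal (adjacencyMatrix-sym G)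
    (ψ-eigenvector j) (ψ-eigenvector i) (decreasing j<i))

  open OrthogonalDecomposition {f = f} {ψ = ψ} f≈∑ψ orthogonal

  N₀ = ∥ ψ zero ∥²

  -- P(k) is a row sum of P(A), here the row of vertex `zero`, which exists because n is a
  -- successor.
  0≤P[k] : 0ℝ ≤ P (fromℕ k)
  0≤P[k] = begin
    0ℝ                 ≤⟨ sum-nonneg (λ v → *-nonneg (PA-nonneg zero v) 0≤1) ⟩
    (PA · ones) zero   ≈⟨ PA-eigenvector (ones-eigenvector G regular) .scales zero ⟩
    P (fromℕ k) * 1ℝ   ≈⟨ *-identityʳ _ ⟩
    P (fromℕ k)        ∎

  0<D : 0ℝ < D
  0<D = x<y⇒0<y-x (<-≤-trans μ<0 0≤P[k])

  D⁻¹ = inv D (inj₂ 0<D)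

  p≤μ : ∀ i → p (suc i) * ∥ ψ (suc i) ∥² ≤ μ * ∥ ψ (suc i) ∥²
  p≤μ i with toℕ (suc i) ℕ.≤? t
  -- For indices 1 to t the design condition makes the component vanish, so both sides are zero
  -- whatever the value of P.
  ... | yes i≤t = ≤-reflexive (≈.trans (zero-norm (p (suc i))) (≈.sym (zero-norm μ)))
    where
    zero-norm : ∀ x → x * ∥ ψ (suc i) ∥² ≈ 0ℝ
    zero-norm x = ≈.trans (*-congˡ {x = x} (sum-zero λ v →
      ≈.trans (*-congʳ {x = ψ (suc i) v} (proj₁ (φ≈0 (suc i) (ℕ.s≤s ℕ.z≤n) i≤t v)))
              (zeroˡ (ψ (suc i) v)))) (zeroʳ x)
  ... | no i≰t = begin
    p (suc i) * ∥ ψ (suc i) ∥²  ≈⟨ *-comm _ _ ⟩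
    ∥ ψ (suc i) ∥² * p (suc i)  ≤⟨ *-monoˡ-≤ (sum-nonneg λ v → x²-nonneg (ψ (suc i) v))
                                     (maxAfter-upper t (P ∘ θ) (suc i) (ℕ.≰⇒> i≰t)) ⟩
    ∥ ψ (suc i) ∥² * μ          ≈⟨ *-comm _ _ ⟩
    μ * ∥ ψ (suc i) ∥²          ∎

  -- Summing f over all vertices leaves only ψ₀: the other components are orthogonal to the all-ones
  -- vector, an eigenvector for θ₀.
  ∑ψ₀≈s : sum (ψ zero) ≈ s
  ∑ψ₀≈s = ≈.sym (≈.trans (fromℕ-sum C) (≈.trans (sum-cong-≋ f≈∑ψ)
    (≈.trans (∑-comm (λ v i → ψ i v)) (sum-single zero ∑ψᵢ≈0))))
    where
    ∑ψᵢ≈0 : ∀ i → i ≢ zero → sum (ψ i) ≈ 0ℝ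
    ∑ψᵢ≈0 zero    0≢0 = contradiction ≡.refl 0≢0
    ∑ψᵢ≈0 (suc i) _   = ≈.trans (sum-cong-≋ λ v → ≈.sym (*-identityˡ (ψ (suc i) v)))
      (eigenvectors-orthogonal {a = θ zero} {φ = ones} (adjacencyMatrix-sym G)
        (IsEigenvector-cong (λ _ _ → ≈.refl) (≈.sym θ₀≈k) (ones-eigenvector G regular))
        (ψ-eigenvector (suc i)) (decreasing ℕ.z<s))

  -- The vector nψ₀ is constantly s, so n⟨ψ₀,ψ₀⟩ = ⟨nψ₀,ψ₀⟩ is s times the sum of ψ₀, again s.
  nN₀≈s² : fromℕ n * N₀ ≈ s * s
  nN₀≈s² = ≈.trans (≈.sym (⟨,⟩-scaleˡ (fromℕ n) (ψ zero) (ψ zero)))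
    (≈.trans (⟨,⟩-congʳ {φ = ψ zero} nψ₀≈s)
    (≈.trans (≈.sym (*-distribˡ-sum s (ψ zero))) (*-congˡ ∑ψ₀≈s)))
    where
    nψ₀≈s : ∀ v → fromℕ n * ψ zero v ≈ s
    nψ₀≈s v = ≈.trans
      (valency-eigenvector-constant G K K-spec diameter regular ψ₀-eigenvector v) ∑ψ₀≈s

  0≤DN₀+μs : 0ℝ ≤ D * N₀ + μ * s
  0≤DN₀+μs = begin
    0ℝ                    ≤⟨ sum-nonneg (λ u → *-nonneg (fromℕ-nonneg (C u))
                               (sum-nonneg λ v → *-nonneg (PA-nonneg u v) (fromℕ-nonneg (C v)))) ⟩
    ⟨ f , PA · f ⟩        ≤⟨ quadratic-form-≤ {M = PA} {p} {μ} PA-ψ p≤μ ⟩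
    D * N₀ + μ * ∥ f ∥²   ≤⟨ +-mono-≤ (≤.refl {D * N₀}) μ∥f∥²≤μs ⟩
    D * N₀ + μ * s        ∎
    where
    s≤∥f∥² : s ≤ ∥ f ∥²
    s≤∥f∥² = ≤-trans (≤-reflexive (fromℕ-sum C)) (sum-mono-≤ λ v → fromℕ≤fromℕ² (C v))

    μ∥f∥²≤μs : μ * ∥ f ∥² ≤ μ * s
    μ∥f∥²≤μs = *-antimonoˡ-≤ (<⇒≤ μ<0) s≤∥f∥²

  0≤Dc+μ : 0ℝ ≤ D * c + μ
  -- Multiplying by the positive factors n and s avoids division: nN₀ = s² = s(cn) turns n(DN₀ + μs)
  -- into ns(Dc + μ).
  0≤Dc+μ = *-cancelˡ-≤ 0<s (*-cancelˡ-≤ (fromℕ-pos n) (begin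
    fromℕ n * (s * 0ℝ)                       ≈⟨ ≈.trans (*-congˡ (zeroʳ s)) (zeroʳ (fromℕ n)) ⟩
    0ℝ                                       ≤⟨ *-nonneg (fromℕ-nonneg n) 0≤DN₀+μs ⟩
    fromℕ n * (D * N₀ + μ * s)               ≈⟨ expand (fromℕ n) D N₀ μ s ⟩
    D * (fromℕ n * N₀) + fromℕ n * (s * μ)   ≈⟨ +-congʳ (*-congˡ nN₀≈scn) ⟩
    D * (s * (c * fromℕ n)) + fromℕ n * (s * μ)
                                             ≈⟨ collect (fromℕ n) D c μ s ⟩
    fromℕ n * (s * (D * c + μ))              ∎))
    where
    nN₀≈scn : fromℕ n * N₀ ≈ s * (c * fromℕ n)
    nN₀≈scn = ≈.trans nN₀≈s² (*-congˡ (≈.sym (fromℚ-/-*-fromℕ (cardinality C) n)))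

    0<s : 0ℝ < s
    0<s = fromℕ-pos (cardinality C) {{nonempty⇒cardinality≢0 nonempty}}

    expand : ∀ n D N m s → n * (D * N + m * s) ≈ D * (n * N) + n * (s * m)
    expand n D N m s = termwise λ i →
      solve 5 (λ n D N m s → n :* (D :* N :+ m :* s) := D :* (n :* N) :+ n :* (s :* m)) ≡.refl
        (seq n i) (seq D i) (seq N i) (seq m i) (seq s i)

    collect : ∀ n D c m s → D * (s * (c * n)) + n * (s * m) ≈ n * (s * (D * c + m))
    collect n D c m s = termwise λ i →
      solve 5 (λ n D c m s → D :* (s :* (c :* n)) :+ n :* (s :* m) := n :* (s :* (D :* c :+ m))) ≡.refl
        (seq n i) (seq D i) (seq c i) (seq m i) (seq s i)

  rearrange : ∀ x y z → x * (y * z) ≈ y * (z * x)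
  rearrange x y z = termwise λ n →
    solve 3 (λ x y z → x :* (y :* z) := y :* (z :* x)) ≡.refl (seq x n) (seq y n) (seq z n)

  +-as-- : ∀ x y z → x * y + z ≈ x * y - (- z)
  +-as-- x y z = termwise λ n →
    solve 3 (λ x y z → x :* y :+ z := x :* y :- (:- z)) ≡.refl (seq x n) (seq y n) (seq z n)
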